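{- Let $r$ be a prime power, $\mathbb F_r$ the field with $r$ elements, and $\mathbb A=\mathbb F_r[T]$. For integers $0\le j\le n$, $$\begin{Bmatrix}n\\ j\end{Bmatrix}_A=\frac{D_n}{D_j\,D_{n-j}^{\,r^j}}.$$
   Context: Set $[i]=T^{r^i}-T$ for $i\ge1$, $D_0=1$, and $D_i=[i][i-1]^r\cdots[1]^{r^{i-1}}$ for $i\ge 1$. For $d\ge 0$ let $\mathbb A(d)=\{\alpha\in\mathbb A:\deg\alpha<d\}$ and $e_n(z)=\prod_{\alpha\in\mathbb A(n)}(z-\alpha)$. The $A$-Stirling-Carlitz numbers of the second kind $\begin{Bmatrix}n\\ k\end{Bmatrix}_A\in\mathbb F_r(T)$ ($0\le k\le n$) are defined by the identity $\sum_{k=0}^n e_k(z)\begin{Bmatrix}n\\ k\end{Bmatrix}_A=z^{r^n}$. -}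

module Defs where

open import Level using (Level; _⊔_)
open import Data.Nat as ℕ using (ℕ; zero; suc; _∸_; _≤_)
open import Data.Nat.Primality using (Prime)
open import Data.Fin using (Fin)
open import Data.Vec using (Vec; []; _∷_)
open import Data.List as List using (List; []; _∷_; map; concatMap; foldr; upTo)
open import Data.Product using (Σ; ∃; _×_; _,_; proj₁; proj₂)
open import Relation.Binary.PropositionalEquality using (_≡_)
open import Relation.Nullary using (¬_)
open import Algebra.Bundles using (CommutativeRing)
open import Algebra.Bundles.Raw using (RawRing)

private variable c ℓ : Level

module RawOps (R : RawRing c ℓ) where
  open RawRing R

  pow : Carrier → ℕ → Carrier
  pow x zero    = 1#
  pow x (suc m) = x * pow x m

  prod : List Carrier → Carrier
  prod = foldr _*_ 1#

  sumTo : ℕ → (ℕ → Carrier) → Carrier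
  sumTo zero    f = f zero
  sumTo (suc n) f = sumTo n f + f (suc n)

-- Univariate polynomials over a raw ring: coefficient lists, lowest
-- degree first; equality = coefficientwise equality (trailing zeros
-- are irrelevant).

module PolyOps (R : RawRing c ℓ) where
  open RawRing R

  Poly : Set c
  Poly = List Carrier

  coeff : Poly → ℕ → Carrier
  coeff []       _       = 0#
  coeff (a ∷ p)  zero    = a
  coeff (a ∷ p)  (suc i) = coeff p i

  _≈P_ : Poly → Poly → Set ℓ
  p ≈P q = ∀ i → coeff p i ≈ coeff q i

  _+P_ : Poly → Poly → Poly
  []      +P q       = q
  (a ∷ p) +P []      = a ∷ p
  (a ∷ p) +P (b ∷ q) = (a + b) ∷ (p +P q)

  negP : Poly → Poly
  negP = map -_

  scale : Carrier → Poly → Poly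
  scale a = map (a *_)

  _*P_ : Poly → Poly → Poly
  []      *P q = []
  (a ∷ p) *P q = scale a q +P (0# ∷ (p *P q))

  const : Carrier → Poly
  const a = a ∷ []

  X : Poly
  X = 0# ∷ 1# ∷ []

  polyRawRing : RawRing c ℓ
  polyRawRing = record
    { Carrier = Poly ; _≈_ = _≈P_ ; _+_ = _+P_ ; _*_ = _*P_
    ; -_ = negP ; 0# = [] ; 1# = 1# ∷ [] }

-- Field of fractions of a raw ring: pairs (numerator , denominator),
-- equality by cross multiplication.  Elements with zero denominator are
-- excluded by explicit hypotheses where they matter.

module FracOps (R : RawRing c ℓ) where
  open RawRing R

  Frac : Set c
  Frac = Carrier × Carrier

  num den : Frac → Carrier
  num = proj₁
  den = proj₂

  _≈F_ : Frac → Frac → Set ℓ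
  (a , b) ≈F (a' , b') = (a * b') ≈ (a' * b)

  fracRawRing : RawRing c ℓ
  fracRawRing = record
    { Carrier = Frac ; _≈_ = _≈F_
    ; _+_ = λ { (a , b) (a' , b') → ((a * b') + (a' * b)) , (b * b') }
    ; _*_ = λ { (a , b) (a' , b') → (a * a') , (b * b') }
    ; -_  = λ { (a , b) → (- a) , b }
    ; 0#  = 0# , 1# ; 1# = 1# , 1# }

  ι : Carrier → Frac
  ι a = a , 1#

PrimePower : ℕ → Set
PrimePower r = Σ ℕ λ p → Σ ℕ λ k → Prime p × (1 ≤ k) × (r ≡ p ℕ.^ k)

record IsFiniteField {c ℓ} (F : CommutativeRing c ℓ) (r : ℕ)
                     (f : Fin r → CommutativeRing.Carrier F) : Set (c ⊔ ℓ) where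
  open CommutativeRing F
  field
    1≉0       : ¬ (1# ≈ 0#)
    inverse   : ∀ x → ¬ (x ≈ 0#) → ∃ λ y → (x * y) ≈ 1#
    f-surj    : ∀ x → ∃ λ i → f i ≈ x
    f-inj     : ∀ i j → f i ≈ f j → i ≡ j

allVecs : (r d : ℕ) → List (Vec (Fin r) d)
allVecs r zero    = [] ∷ []
allVecs r (suc d) = concatMap (λ i → map (i ∷_) (allVecs r d)) (List.allFin r)

module Carlitz {c ℓ} (F : CommutativeRing c ℓ) (r : ℕ)
                     (f : Fin r → CommutativeRing.Carrier F) where

  Fr : RawRing c ℓ
  Fr = CommutativeRing.rawRing F

  module PA = PolyOps Fr
  𝔸 : RawRing c ℓ
  𝔸 = PA.polyRawRing
  open RawRing 𝔸 using () renaming (Carrier to A; _≈_ to _≈A_; _*_ to _*A_; _+_ to _+A_; -_ to -A_; 0# to 0A; 1# to 1A)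
  open RawOps 𝔸 using () renaming (pow to powA; prod to prodA)

  T : A
  T = PA.X

  bracket : ℕ → A
  bracket i = powA T (r ℕ.^ i) +A (-A T)

  D : ℕ → A
  D i = prodA (map (λ m → powA (bracket m) (r ℕ.^ (i ∸ m))) (map suc (upTo i)))

  -- 𝔸(d) = { α ∈ 𝔸 : deg α < d } : polynomials with coefficients (f v₀ , … , f v_{d-1})
  toPoly : ∀ {d} → Vec (Fin r) d → A
  toPoly []      = []
  toPoly (i ∷ v) = f i ∷ toPoly v

  𝔸< : ℕ → List A
  𝔸< d = map toPoly (allVecs r d)

  module FK = FracOps 𝔸
  K : RawRing c ℓ
  K = FK.fracRawRing
  module PK = PolyOps K
  Kz : RawRing c ℓ
  Kz = PK.polyRawRing
  open RawRing Kz using () renaming (Carrier to KzC; _+_ to _+z_; _*_ to _*z_; -_ to -z_)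
  open RawOps Kz using () renaming (pow to powz; prod to prodz; sumTo to sumz)

  z : KzC
  z = PK.X

  e : ℕ → KzC
  e n = prodz (map (λ α → z +z (-z (PK.const (FK.ι α)))) (𝔸< n))

  -- S : the candidate values {n k}_A (k = 0..n) satisfy the defining identity
  --   Σ_{k=0}^n e_k(z) S_k = z^{r^n}  in F_r(T)[z],
  -- with all S_k genuine elements of F_r(T) (nonzero denominators).
  IsStirling2 : ℕ → (ℕ → FK.Frac) → Set ℓ
  IsStirling2 n S =
      (∀ k → k ≤ n → ¬ (FK.den (S k) ≈A 0A))
    × (sumz n (λ k → e k *z PK.const (S k)) PK.≈P powz z (r ℕ.^ n))

  quotientD : ℕ → ℕ → FK.Frac
  quotientD n j = D n , (D j *A powA (D (n ∸ j)) (r ℕ.^ j))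

{-# OPTIONS --safe #-}

-- Put r = |F|.  Dividing a binary form by its linear factors gives ∏_{a ∈ F} (x - a y) = x^r - y^(r-1) x
-- in every F-algebra, and the invariance of the product under x ↦ x + y makes x ↦ x^r additive.
-- Let E_0(z) = z and E_(k+1)(z) = E_k(z)^r - D_k^(r-1) E_k(z).  Then E_k is F-linear and satisfies
-- E_(k+1)(T z) = T E_(k+1)(z) + [k+1] E_k(z)^r, whence E_k(T^k) = D_k, and the product formula
-- gives e_k = E_k by induction.  Raising Σ_k E_k(z) Q(n,k) = z^(r^n) to the power r and replacing
-- E_k^r by E_(k+1) + D_k^(r-1) E_k yields Q(n+1,k) = D_k^(r-1) Q(n,k)^r + Q(n,k-1)^r, which the
-- quotients D_n / (D_k D_(n-k)^(r^k)) satisfy because [n+1-k]^(r^k) + [k] = [n+1].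
-- Evaluating at z = T^j, where E_k vanishes for k > j, shows that the coefficients are unique.

module Submission where

open import Defs
open import Level using (_⊔_)
open import Algebra.Bundles using (CommutativeRing; RawRing)
open import Algebra.Morphism.Structures using (module RingMorphisms)
import Algebra.Morphism.Construct.Composition as Composition
open import Data.Fin as Fin using (Fin; zero; suc)
open import Data.Fin.Permutation using (Permutation′; permutation)
import Data.Fin.Properties as FinP
import Data.Integer as ℤ
open ℤ using (+_)
import Data.Integer.Properties as ℤP
open import Data.List as List using (List; []; _∷_)
import Data.List.Properties as ListP
open import Data.Maybe.Base using (Maybe; just; nothing)
open import Data.Nat as ℕ using (ℕ; zero; suc; _≤_; _<_; z≤n; s≤s)
open import Data.Nat.Induction using (<-rec)
import Data.Nat.Properties as ℕP
open import Data.Product using (Σ; _,_; proj₁; proj₂)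
open import Data.Vec using (Vec; []; _∷_; _∷ʳ_; replicate)
open import Function using (_∘_)
open import Relation.Binary.Bundles using (Setoid)
open import Relation.Binary.PropositionalEquality as ≡ using (_≡_; _≢_)
import Relation.Binary.Reasoning.Setoid
open import Relation.Nullary using (¬_; Dec; yes; no; contradiction)

-- The defining identity is an equality of polynomials in `z`, but only its values at points of the
-- field of fractions are used. So `E k` is a function on a ring rather than a polynomial, and the
-- points `T ^ j` suffice to separate the coefficients. The quotients enter as a family `Q` known
-- only through its products with the denominators; identities between them are proved by clearing
-- denominators and cancelling powers of `D k`. The bracket identity holds because the k-fold
-- Frobenius sends `[m]` to T^(r^(m+k)) - T^(r^k), which is [m+k] - [k]. The rule for E_(k+1)(T z)
-- survives the recursion because D_(k+1) = [k+1] D_k^r gives D_(k+1)^(r-1) [k+1] = [k+1]^r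
-- (D_k^(r-1))^r. The obstacle is the setting: pairs with possibly zero denominators do not form a
-- ring, so the calculations are made over an abstract commutative ring and carried back to the raw
-- pairs only at the end.

-- Integer coefficients in a commutative ring, for the ring solver.

module IntegerSolver {c ℓ} (R : CommutativeRing c ℓ) where
  open CommutativeRing R
  open ℤ using (ℤ; -[1+_]; _⊖_)
  open import Algebra.Properties.Ring ring
  open import Algebra.Properties.Semiring.Mult.TCOptimised semiring
  open import Algebra.Solver.Ring.AlmostCommutativeRing
    using (fromCommutativeRing; _-Raw-AlmostCommutative⟶_)
  open import Relation.Binary.Reasoning.Setoid setoid

  ⟦_⟧ℤ : ℤ → Carrier
  ⟦ + n ⟧ℤ      = n × 1#
  ⟦ -[1+ n ] ⟧ℤ = - (suc n × 1#)

  -‿homoℤ : ∀ i → ⟦ ℤ.- i ⟧ℤ ≈ - ⟦ i ⟧ℤ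
  -‿homoℤ (+ zero)  = sym -0#≈0#
  -‿homoℤ (+ suc n) = refl
  -‿homoℤ -[1+ n ]  = sym (-‿involutive _)

  ⊖-homo : ∀ m n → ⟦ m ⊖ n ⟧ℤ ≈ m × 1# - n × 1#
  ⊖-homo zero    zero    = sym (-‿inverseʳ 0#)
  ⊖-homo zero    (suc n) = sym (+-identityˡ _)
  ⊖-homo (suc m) zero    = sym (trans (+-congˡ -0#≈0#) (+-identityʳ _))
  ⊖-homo (suc m) (suc n) = begin
    ⟦ suc m ⊖ suc n ⟧ℤ                    ≡⟨ ≡.cong ⟦_⟧ℤ (ℤP.[1+m]⊖[1+n]≡m⊖n m n) ⟩
    ⟦ m ⊖ n ⟧ℤ                            ≈⟨ ⊖-homo m n ⟩
    m × 1# - n × 1#                       ≈⟨ +-congʳ (+-identityʳ _) ⟨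
    m × 1# + 0# - n × 1#                  ≈⟨ +-congʳ (+-congˡ (-‿inverseʳ 1#)) ⟨
    m × 1# + (1# - 1#) - n × 1#           ≈⟨ +-congʳ (+-assoc _ _ _) ⟨
    m × 1# + 1# - 1# - n × 1#             ≈⟨ +-assoc _ _ _ ⟩
    m × 1# + 1# + (- 1# - n × 1#)         ≈⟨ +-cong (+-comm _ _) (-‿+-comm _ _) ⟩
    1# + m × 1# - (1# + n × 1#)           ≈⟨ +-cong (1+× m 1#) (-‿cong (1+× n 1#)) ⟨
    suc m × 1# - suc n × 1#               ∎

  +-homoℤ : ∀ i j → ⟦ i ℤ.+ j ⟧ℤ ≈ ⟦ i ⟧ℤ + ⟦ j ⟧ℤ
  +-homoℤ (+ m)    (+ n)    = ×-homo-+ 1# m n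
  +-homoℤ (+ m)    -[1+ n ] = ⊖-homo m (suc n)
  +-homoℤ -[1+ m ] (+ n)    = trans (⊖-homo n (suc m)) (+-comm _ _)
  +-homoℤ -[1+ m ] -[1+ n ] = begin
    - (suc (suc (m ℕ.+ n)) × 1#)      ≈⟨ -‿cong (reflexive (≡.cong (_× 1#) (≡.sym (≡.cong suc (ℕP.+-suc m n))))) ⟩
    - ((suc m ℕ.+ suc n) × 1#)        ≈⟨ -‿cong (×-homo-+ 1# (suc m) (suc n)) ⟩
    - (suc m × 1# + suc n × 1#)       ≈⟨ -‿+-comm _ _ ⟨
    - (suc m × 1#) - suc n × 1#       ∎

  *-homo⁺ : ∀ m j → ⟦ + m ℤ.* j ⟧ℤ ≈ ⟦ + m ⟧ℤ * ⟦ j ⟧ℤ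
  *-homo⁺ m (+ n)    = begin
    ⟦ + m ℤ.* + n ⟧ℤ        ≡⟨ ≡.cong ⟦_⟧ℤ (ℤP.pos-* m n) ⟨
    (m ℕ.* n) × 1#          ≈⟨ ×1-homo-* m n ⟩
    (m × 1#) * (n × 1#)     ∎
  *-homo⁺ m -[1+ n ] = begin
    ⟦ + m ℤ.* (ℤ.- (+ suc n)) ⟧ℤ  ≡⟨ ≡.cong ⟦_⟧ℤ (ℤP.neg-distribʳ-* (+ m) (+ suc n)) ⟨
    ⟦ ℤ.- (+ m ℤ.* + suc n) ⟧ℤ    ≈⟨ -‿homoℤ (+ m ℤ.* + suc n) ⟩
    - ⟦ + m ℤ.* + suc n ⟧ℤ        ≈⟨ -‿cong (*-homo⁺ m (+ suc n)) ⟩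
    - ((m × 1#) * (suc n × 1#))   ≈⟨ -‿distribʳ-* _ _ ⟩
    (m × 1#) * - (suc n × 1#)     ∎

  *-homoℤ : ∀ i j → ⟦ i ℤ.* j ⟧ℤ ≈ ⟦ i ⟧ℤ * ⟦ j ⟧ℤ
  *-homoℤ (+ m)    j = *-homo⁺ m j
  *-homoℤ -[1+ m ] j = begin
    ⟦ (ℤ.- (+ suc m)) ℤ.* j ⟧ℤ    ≡⟨ ≡.cong ⟦_⟧ℤ (ℤP.neg-distribˡ-* (+ suc m) j) ⟨
    ⟦ ℤ.- (+ suc m ℤ.* j) ⟧ℤ      ≈⟨ -‿homoℤ (+ suc m ℤ.* j) ⟩
    - ⟦ + suc m ℤ.* j ⟧ℤ          ≈⟨ -‿cong (*-homo⁺ (suc m) j) ⟩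
    - ((suc m × 1#) * ⟦ j ⟧ℤ)     ≈⟨ -‿distribˡ-* _ _ ⟩
    - (suc m × 1#) * ⟦ j ⟧ℤ       ∎

  homomorphism : ℤ.+-*-rawRing -Raw-AlmostCommutative⟶ fromCommutativeRing R
  homomorphism = record
    { ⟦_⟧    = ⟦_⟧ℤ
    ; +-homo = +-homoℤ
    ; *-homo = *-homoℤ
    ; -‿homo = -‿homoℤ
    ; 0-homo = refl
    ; 1-homo = refl
    }

  -- Distinct integers may have equal images in positive characteristic, so inequality of integers
  -- decides nothing.
  ≟ℤ : ∀ i j → Maybe (⟦ i ⟧ℤ ≈ ⟦ j ⟧ℤ)
  ≟ℤ i j with i ℤP.≟ j
  ... | yes i≡j = just (reflexive (≡.cong ⟦_⟧ℤ i≡j))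
  ... | no  _   = nothing

  open import Algebra.Solver.Ring _ _ homomorphism ≟ℤ public
    using (solve; _:=_; _:+_; _:*_; _:-_; :-_; con)

-- Finite sums, additive maps and integrality in a commutative ring.

module RingProperties {c ℓ} (R : CommutativeRing c ℓ) where
  open CommutativeRing R public hiding (zero)
  open import Algebra.Properties.Ring ring public
  open import Algebra.Properties.CommutativeSemiring.Exp commutativeSemiring public
  open import Algebra.Properties.CommutativeMonoid.Sum *-commutativeMonoid public
    using () renaming (sum to ∏; sum-cong-≋ to ∏-cong; ∑-comm to ∏-comm; sum-permute to ∏-permute; sum-remove to ∏-remove;
                       ∑-distrib-+ to ∏-distrib-*; sum-replicate to ∏-replicate)
  open RawOps rawRing public using (sumTo)
  open IntegerSolver R public using (solve; _:=_; _:+_; _:*_; _:-_; :-_; con)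
  open import Relation.Binary.Reasoning.Setoid setoid public

  NonTrivial : Set ℓ
  NonTrivial = ¬ (1# ≈ 0#)

  Integral : Set (c ⊔ ℓ)
  Integral = ∀ x y → x * y ≈ 0# → ¬ (x ≈ 0#) → y ≈ 0#

  1^n≈1 : ∀ n → 1# ^ n ≈ 1#
  1^n≈1 zero    = refl
  1^n≈1 (suc n) = trans (*-identityˡ _) (1^n≈1 n)

  additive⇒0 : (h : Carrier → Carrier) → (∀ {x y} → x ≈ y → h x ≈ h y) →
               (∀ x y → h (x + y) ≈ h x + h y) → h 0# ≈ 0#
  additive⇒0 h h-cong h-+ = x+x≈x⇒x≈0 (h 0#) (trans (sym (h-+ 0# 0#)) (h-cong (+-identityˡ 0#)))

  additive⇒neg : (h : Carrier → Carrier) → (∀ {x y} → x ≈ y → h x ≈ h y) →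
                 (∀ x y → h (x + y) ≈ h x + h y) → ∀ x → h (- x) ≈ - h x
  additive⇒neg h h-cong h-+ x = +-inverseˡ-unique (h (- x)) (h x) (begin
    h (- x) + h x   ≈⟨ h-+ _ _ ⟨
    h (- x + x)     ≈⟨ h-cong (-‿inverseˡ x) ⟩
    h 0#            ≈⟨ additive⇒0 h h-cong h-+ ⟩
    0#              ∎)

  sumTo-cong : ∀ n {f g} → (∀ k → k ≤ n → f k ≈ g k) → sumTo n f ≈ sumTo n g
  sumTo-cong zero    f≈g = f≈g 0 z≤n
  sumTo-cong (suc n) f≈g =
    +-cong (sumTo-cong n (λ k k≤n → f≈g k (ℕP.m≤n⇒m≤1+n k≤n))) (f≈g (suc n) ℕP.≤-refl)

  sumTo-zero : ∀ n {f} → (∀ k → k ≤ n → f k ≈ 0#) → sumTo n f ≈ 0#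
  sumTo-zero zero    f≈0 = f≈0 0 z≤n
  sumTo-zero (suc n) f≈0 = trans
    (+-cong (sumTo-zero n (λ k k≤n → f≈0 k (ℕP.m≤n⇒m≤1+n k≤n))) (f≈0 (suc n) ℕP.≤-refl))
    (+-identityˡ 0#)

  sumTo-single : ∀ n {f} m → m ≤ n → (∀ k → k ≤ n → k ≢ m → f k ≈ 0#) → sumTo n f ≈ f m
  sumTo-single zero    .0 z≤n f≈0 = refl
  sumTo-single (suc n) {f} m m≤1+n f≈0 with m ℕ.≟ suc n
  ... | yes ≡.refl = trans
    (+-congʳ (sumTo-zero n (λ k k≤n → f≈0 k (ℕP.m≤n⇒m≤1+n k≤n) (ℕP.<⇒≢ (s≤s k≤n)))))
    (+-identityˡ _)
  ... | no m≢1+n = trans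
    (+-cong (sumTo-single n m (ℕP.≤-pred (ℕP.≤∧≢⇒< m≤1+n m≢1+n))
              (λ k k≤n → f≈0 k (ℕP.m≤n⇒m≤1+n k≤n)))
            (f≈0 (suc n) ℕP.≤-refl (λ eq → m≢1+n (≡.sym eq))))
    (+-identityʳ _)

  sumTo-minus : ∀ n f g → sumTo n (λ k → f k - g k) ≈ sumTo n f - sumTo n g
  sumTo-minus zero    f g = refl
  sumTo-minus (suc n) f g = trans (+-congʳ (sumTo-minus n f g))
    (solve 4 (λ a b x y → (a :- b) :+ (x :- y) := (a :+ x) :- (b :+ y)) refl _ _ _ _)

  sumTo-additive : (h : Carrier → Carrier) → (∀ x y → h (x + y) ≈ h x + h y) →
                   ∀ n f → h (sumTo n f) ≈ sumTo n (λ k → h (f k))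
  sumTo-additive h h-+ zero    f = refl
  sumTo-additive h h-+ (suc n) f = trans (h-+ _ _) (+-congʳ (sumTo-additive h h-+ n f))

-- Products indexed by coefficient vectors.

module VecProducts {c ℓ} (R : CommutativeRing c ℓ) (r : ℕ) where
  open RingProperties R
  open RawOps rawRing using (prod)

  ∏ᵥ : ∀ d → (Vec (Fin r) d → Carrier) → Carrier
  ∏ᵥ zero    g = g []
  ∏ᵥ (suc d) g = ∏ (λ i → ∏ᵥ d (λ v → g (i ∷ v)))

  ∏ᵥ-cong : ∀ d {g h} → (∀ v → g v ≈ h v) → ∏ᵥ d g ≈ ∏ᵥ d h
  ∏ᵥ-cong zero    g≈h = g≈h []
  ∏ᵥ-cong (suc d) g≈h = ∏-cong (λ i → ∏ᵥ-cong d (λ v → g≈h (i ∷ v)))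

  -- `∏ᵥ` branches on the first entry, the constant coefficient, whereas the induction on the degree
  -- has to peel off the last entry, the coefficient of `T ^ d`.
  ∏ᵥ-∷ʳ : ∀ d g → ∏ᵥ (suc d) g ≈ ∏ᵥ d (λ v → ∏ (λ i → g (v ∷ʳ i)))
  ∏ᵥ-∷ʳ zero    g = refl
  ∏ᵥ-∷ʳ (suc d) g = ∏-cong (λ i → ∏ᵥ-∷ʳ d (λ v → g (i ∷ v)))

  ∏ᵥ-swap : ∀ d (g : Vec (Fin r) d → Fin r → Carrier) →
            ∏ᵥ d (λ v → ∏ (g v)) ≈ ∏ (λ i → ∏ᵥ d (λ v → g v i))
  ∏ᵥ-swap zero    g = refl
  ∏ᵥ-swap (suc d) g = trans (∏-cong (λ j → ∏ᵥ-swap d (λ v → g (j ∷ v))))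
    (∏-comm (λ j i → ∏ᵥ d (λ v → g (j ∷ v) i)))

  prod-++ : ∀ xs ys → prod (xs List.++ ys) ≈ prod xs * prod ys
  prod-++ []       ys = sym (*-identityˡ _)
  prod-++ (x ∷ xs) ys = trans (*-congˡ (prod-++ xs ys)) (sym (*-assoc _ _ _))

  prod-map-concat : ∀ {a} {X : Set a} (g : X → Carrier) xss →
    prod (List.map g (List.concat xss)) ≈ prod (List.map (λ xs → prod (List.map g xs)) xss)
  prod-map-concat g []         = refl
  prod-map-concat g (xs ∷ xss) = begin
    prod (List.map g (xs List.++ List.concat xss))
      ≡⟨ ≡.cong prod (ListP.map-++ g xs (List.concat xss)) ⟩
    prod (List.map g xs List.++ List.map g (List.concat xss))
      ≈⟨ prod-++ (List.map g xs) _ ⟩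
    prod (List.map g xs) * prod (List.map g (List.concat xss))
      ≈⟨ *-congˡ (prod-map-concat g xss) ⟩
    prod (List.map g xs) * prod (List.map (λ xs → prod (List.map g xs)) xss) ∎

  prod-tabulate : ∀ {n} (g : Fin n → Carrier) → prod (List.tabulate g) ≡ ∏ g
  prod-tabulate {zero}  g = ≡.refl
  prod-tabulate {suc n} g = ≡.cong (g Fin.zero *_) (prod-tabulate (λ i → g (Fin.suc i)))

  -- Replaces the list enumeration of the definition by nested finite products, whose order can be
  -- exchanged.
  prod-allVecs : ∀ d (g : Vec (Fin r) d → Carrier) → prod (List.map g (allVecs r d)) ≈ ∏ᵥ d g
  prod-allVecs zero    g = *-identityʳ _
  prod-allVecs (suc d) g = begin
    prod (List.map g (List.concat (List.map (λ i → List.map (i ∷_) (allVecs r d)) (List.allFin r))))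
      ≈⟨ prod-map-concat g (List.map (λ i → List.map (i ∷_) (allVecs r d)) (List.allFin r)) ⟩
    prod (List.map (λ vs → prod (List.map g vs)) (List.map (λ i → List.map (i ∷_) (allVecs r d)) (List.allFin r)))
      ≡⟨ ≡.cong prod (ListP.map-∘ (List.allFin r)) ⟨
    prod (List.map (λ i → prod (List.map g (List.map (i ∷_) (allVecs r d)))) (List.allFin r))
      ≡⟨ ≡.cong prod (ListP.map-tabulate {n = r} (λ i → i) G) ⟩
    prod (List.tabulate (λ i → prod (List.map g (List.map (i ∷_) (allVecs r d)))))
      ≡⟨ prod-tabulate G ⟩
    ∏ (λ i → prod (List.map g (List.map (i ∷_) (allVecs r d))))
      ≈⟨ ∏-cong (λ i → trans (reflexive (≡.cong prod (≡.sym (ListP.map-∘ (allVecs r d))))) (prod-allVecs d (λ v → g (i ∷ v)))) ⟩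
    ∏ (λ i → ∏ᵥ d (λ v → g (i ∷ v))) ∎
    where
    G : Fin r → Carrier
    G i = prod (List.map g (List.map (i ∷_) (allVecs r d)))

-- The Carlitz recursion over an abstract ring.

-- The facts about F_r[T] on which the recursion rests, with `s` standing for r - 1. `D` is given by
-- its recursion instead of its product formula.
record CarlitzData {c ℓ} (R : CommutativeRing c ℓ) (r s : ℕ) : Set (c ⊔ ℓ) where
  open RingProperties R
  field
    φ    : Fin r → Carrier
    ∏-φ  : ∀ x y → ∏ (λ i → x - φ i * y) ≈ x ^ r - y ^ s * x
    ^r-+ : ∀ x y → (x + y) ^ r ≈ x ^ r + y ^ r
    φ^r  : ∀ i → φ i ^ r ≈ φ i
    T    : Carrier
    D    : ℕ → Carrier
    D₀   : D 0 ≈ 1#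
    D₊   : ∀ k → D (suc k) ≈ (T ^ (r ℕ.^ suc k) - T) * D k ^ r

module CarlitzPolynomials {c ℓ} (R : CommutativeRing c ℓ) (r s : ℕ) (r≡1+s : r ≡ suc s)
  (carlitz : CarlitzData R r s) where
  open RingProperties R
  open CarlitzData carlitz
  open VecProducts R r

  br : ℕ → Carrier
  br k = T ^ (r ℕ.^ k) - T

  ^r-suc : ∀ x → x ^ r ≈ x * x ^ s
  ^r-suc x = ^-congʳ x r≡1+s

  ^r-neg : ∀ x → (- x) ^ r ≈ - (x ^ r)
  ^r-neg = additive⇒neg (_^ r) (^-congˡ r) ^r-+

  ^r-minus : ∀ x y → (x - y) ^ r ≈ x ^ r - y ^ r
  ^r-minus x y = trans (^r-+ x (- y)) (+-congˡ (^r-neg y))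

  ^-swap : ∀ x m n → (x ^ m) ^ n ≈ (x ^ n) ^ m
  ^-swap x m n = begin
    (x ^ m) ^ n    ≈⟨ ^-assocʳ x m n ⟩
    x ^ (m ℕ.* n)  ≡⟨ ≡.cong (x ^_) (ℕP.*-comm m n) ⟩
    x ^ (n ℕ.* m)  ≈⟨ ^-assocʳ x n m ⟨
    (x ^ n) ^ m    ∎

  ^r^-suc : ∀ x k → x ^ (r ℕ.^ suc k) ≈ (x ^ (r ℕ.^ k)) ^ r
  ^r^-suc x k = trans (sym (^-assocʳ x r (r ℕ.^ k))) (^-swap x r (r ℕ.^ k))

  ^r^-minus : ∀ k x y → (x - y) ^ (r ℕ.^ k) ≈ x ^ (r ℕ.^ k) - y ^ (r ℕ.^ k)
  ^r^-minus zero x y = solve 2 (λ x y → (x :- y) :* con (+ 1) := x :* con (+ 1) :- y :* con (+ 1)) refl x y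
  ^r^-minus (suc k) x y = begin
    (x - y) ^ (r ℕ.^ suc k)                      ≈⟨ ^r^-suc (x - y) k ⟩
    ((x - y) ^ (r ℕ.^ k)) ^ r                    ≈⟨ ^-congˡ r (^r^-minus k x y) ⟩
    (x ^ (r ℕ.^ k) - y ^ (r ℕ.^ k)) ^ r          ≈⟨ ^r-minus _ _ ⟩
    (x ^ (r ℕ.^ k)) ^ r - (y ^ (r ℕ.^ k)) ^ r    ≈⟨ +-cong (^r^-suc x k) (-‿cong (^r^-suc y k)) ⟨
    x ^ (r ℕ.^ suc k) - y ^ (r ℕ.^ suc k)        ∎

  E : ℕ → Carrier → Carrier
  E zero    z = z
  E (suc k) z = E k z ^ r - D k ^ s * E k z

  E-cong : ∀ k {x y} → x ≈ y → E k x ≈ E k y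
  E-cong zero    x≈y = x≈y
  E-cong (suc k) x≈y = +-cong (^-congˡ r (E-cong k x≈y)) (-‿cong (*-congˡ (E-cong k x≈y)))

  E-+ : ∀ k x y → E k (x + y) ≈ E k x + E k y
  E-+ zero    x y = refl
  E-+ (suc k) x y = begin
    E k (x + y) ^ r - D k ^ s * E k (x + y)
      ≈⟨ +-cong (trans (^-congˡ r (E-+ k x y)) (^r-+ _ _)) (-‿cong (*-congˡ (E-+ k x y))) ⟩
    (E k x ^ r + E k y ^ r) - D k ^ s * (E k x + E k y)
      ≈⟨ solve 5 (λ a b d x y → (a :+ b) :- d :* (x :+ y) := (a :- d :* x) :+ (b :- d :* y)) refl _ _ _ _ _ ⟩
    E (suc k) x + E (suc k) y ∎

  E-φ : ∀ k i x → E k (φ i * x) ≈ φ i * E k x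
  E-φ zero    i x = refl
  E-φ (suc k) i x = begin
    E k (φ i * x) ^ r - D k ^ s * E k (φ i * x)
      ≈⟨ +-cong (trans (^-congˡ r (E-φ k i x)) (trans (^-distrib-* _ _ r) (*-congʳ (φ^r i))))
                (-‿cong (*-congˡ (E-φ k i x))) ⟩
    φ i * E k x ^ r - D k ^ s * (φ i * E k x)
      ≈⟨ solve 4 (λ c a d x → c :* a :- d :* (c :* x) := c :* (a :- d :* x)) refl _ _ _ _ ⟩
    φ i * E (suc k) x ∎

  E-minus-φ : ∀ k i x y → E k (x - φ i * y) ≈ E k x - φ i * E k y
  E-minus-φ k i x y = begin
    E k (x - φ i * y)         ≈⟨ E-+ k x _ ⟩
    E k x + E k (- (φ i * y)) ≈⟨ +-congˡ (additive⇒neg (E k) (E-cong k) (E-+ k) _) ⟩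
    E k x - E k (φ i * y)     ≈⟨ +-congˡ (-‿cong (E-φ k i y)) ⟩
    E k x - φ i * E k y       ∎

  br₁ : br 1 ≈ T ^ r - T
  br₁ = +-congʳ (^-congʳ T (ℕP.*-identityʳ r))

  -- The difference is split at `T ^ r`; additivity of the r-th power makes the upper part
  -- `br k ^ r`.
  br-suc : ∀ k → br (suc k) ≈ br k ^ r + br 1
  br-suc k = begin
    T ^ (r ℕ.^ suc k) - T
      ≈⟨ solve 3 (λ a b t → a :- t := (a :- b) :+ (b :- t)) refl _ (T ^ r) T ⟩
    (T ^ (r ℕ.^ suc k) - T ^ r) + (T ^ r - T)
      ≈⟨ +-cong (trans (+-congʳ (^r^-suc T k)) (sym (^r-minus _ _))) (sym br₁) ⟩
    br k ^ r + br 1 ∎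

  -- Put v = `E (suc k) z` and apply the recursion to the formula for `k`. The multiple of `T`
  -- contributes `T * E (suc (suc k)) z` and a defect (T^r - T) v^r; the bracket term contributes
  -- [k+1]^r v^r. The two brackets add up by `br-suc`.
  E-T* : ∀ k z → E (suc k) (T * z) ≈ T * E (suc k) z + br (suc k) * E k z ^ r
  E-T* zero z = begin
    (T * z) ^ r - D 0 ^ s * (T * z)
      ≈⟨ +-cong (^-distrib-* T z r) (-‿cong (*-congˡ refl)) ⟩
    T ^ r * z ^ r - D 0 ^ s * (T * z)
      ≈⟨ solve 5 (λ X Z d t z → X :* Z :- d :* (t :* z) := t :* (Z :- d :* z) :+ (X :- t) :* Z) refl _ _ _ T z ⟩
    T * (z ^ r - D 0 ^ s * z) + (T ^ r - T) * z ^ r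
      ≈⟨ +-congˡ (*-congʳ br₁) ⟨
    T * E 1 z + br 1 * z ^ r ∎
  E-T* (suc k) z = begin
    E (suc k) (T * z) ^ r - δ * E (suc k) (T * z)
      ≈⟨ +-cong (^-congˡ r (E-T* k z)) (-‿cong (*-congˡ (E-T* k z))) ⟩
    (T * v + b * w) ^ r - δ * (T * v + b * w)
      ≈⟨ +-congʳ (trans (^r-+ _ _) (+-cong (^-distrib-* T v r) (^-distrib-* b w r))) ⟩
    (T ^ r * v ^ r + b ^ r * w ^ r) - δ * (T * v + b * w)
      ≈⟨ solve 8 (λ X V B W δ t v bw → (X :* V :+ B :* W) :- δ :* (t :* v :+ bw)
                   := (X :* V :- δ :* t :* v) :+ (B :* W :- δ :* bw)) refl _ _ _ _ _ _ _ _ ⟩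
    (T ^ r * v ^ r - δ * T * v) + (b ^ r * w ^ r - δ * (b * w))
      ≈⟨ +-congˡ (+-congˡ (-‿cong (trans (sym (*-assoc _ _ _)) (*-congʳ δb≈)))) ⟩
    (T ^ r * v ^ r - δ * T * v) + (b ^ r * w ^ r - (b ^ r * P) * w)
      ≈⟨ +-congˡ (solve 4 (λ B W P w → B :* W :- (B :* P) :* w := B :* (W :- P :* w)) refl _ _ _ _) ⟩
    (T ^ r * v ^ r - δ * T * v) + b ^ r * (w ^ r - P * w)
      ≈⟨ +-congˡ (*-congˡ v^r≈) ⟨
    (T ^ r * v ^ r - δ * T * v) + b ^ r * v ^ r
      ≈⟨ solve 6 (λ X V B δ t v → (X :* V :- δ :* t :* v) :+ B :* V
                   := t :* (V :- δ :* v) :+ (B :+ (X :- t)) :* V) refl _ _ _ _ _ _ ⟩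
    T * (v ^ r - δ * v) + (b ^ r + (T ^ r - T)) * v ^ r
      ≈⟨ +-congˡ (*-congʳ (trans (br-suc (suc k)) (+-congˡ br₁))) ⟨
    T * E (suc (suc k)) z + br (suc (suc k)) * v ^ r ∎
    where
    u = E k z
    v = E (suc k) z
    w = u ^ r
    b = br (suc k)
    δ = D (suc k) ^ s
    P = (D k ^ s) ^ r
    v^r≈ : v ^ r ≈ w ^ r - P * w
    v^r≈ = trans (^r-minus _ _) (+-congˡ (-‿cong (^-distrib-* _ _ r)))
    -- `D (suc k) ^ s` contains `b ^ s`, and one more factor `b` completes it to `b ^ r`. What
    -- remains is the coefficient in the r-th power of the recursion for `v`, so the bracket term
    -- reassembles to `b ^ r * v ^ r`.
    δb≈ : δ * b ≈ b ^ r * P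
    δb≈ = begin
      D (suc k) ^ s * b            ≈⟨ *-congʳ (trans (^-congˡ s (D₊ k)) (^-distrib-* _ _ s)) ⟩
      b ^ s * (D k ^ r) ^ s * b    ≈⟨ solve 3 (λ a d b → a :* d :* b := b :* a :* d) refl _ _ _ ⟩
      b * b ^ s * (D k ^ r) ^ s    ≈⟨ *-cong (sym (^r-suc b)) (^-swap (D k) r s) ⟩
      b ^ r * P                    ∎

  -- Since E_(k+1) = E_k (E_k^(r-1) - D_k^(r-1)), a zero of one `E k` is a zero of all later ones;
  -- `E-T^-suc` supplies the first vanishing.
  E-vanish : ∀ {m k} → m < k → E k (T ^ m) ≈ 0#

  -- Proved together with `E-T^-suc`: the value `D k` at `T ^ k` makes the next function vanish
  -- there, and this vanishing leaves only the bracket term of `E-T*` at `T ^ suc k`.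
  E-T^ : ∀ k → E k (T ^ k) ≈ D k

  E-T^-suc : ∀ k → E (suc k) (T ^ k) ≈ 0#
  E-T^-suc k = begin
    E k (T ^ k) ^ r - D k ^ s * E k (T ^ k) ≈⟨ +-cong (^-congˡ r (E-T^ k)) (-‿cong (*-congˡ (E-T^ k))) ⟩
    D k ^ r - D k ^ s * D k                 ≈⟨ +-congʳ (trans (^r-suc (D k)) (*-comm _ _)) ⟩
    D k ^ s * D k - D k ^ s * D k           ≈⟨ -‿inverseʳ _ ⟩
    0#                                      ∎

  E-T^ zero    = sym D₀
  E-T^ (suc k) = begin
    E (suc k) (T * T ^ k)                                 ≈⟨ E-T* k (T ^ k) ⟩
    T * E (suc k) (T ^ k) + br (suc k) * E k (T ^ k) ^ r  ≈⟨ +-cong (trans (*-congˡ (E-T^-suc k)) (zeroʳ T))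
                                                                   (*-congˡ (^-congˡ r (E-T^ k))) ⟩
    0# + br (suc k) * D k ^ r                             ≈⟨ +-identityˡ _ ⟩
    br (suc k) * D k ^ r                                  ≈⟨ D₊ k ⟨
    D (suc k)                                             ∎

  E-vanish {m} {suc k} (s≤s m≤k) with m ℕ.≟ k
  ... | yes ≡.refl = E-T^-suc k
  ... | no  m≢k    = begin
    E k (T ^ m) ^ r - D k ^ s * E k (T ^ m) ≈⟨ +-congʳ (^r-suc _) ⟩
    E k (T ^ m) * E k (T ^ m) ^ s - D k ^ s * E k (T ^ m)
      ≈⟨ solve 3 (λ e a d → e :* a :- d :* e := e :* (a :- d)) refl _ _ _ ⟩
    E k (T ^ m) * (E k (T ^ m) ^ s - D k ^ s) ≈⟨ *-congʳ (E-vanish (ℕP.≤∧≢⇒< m≤k m≢k)) ⟩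
    0# * (E k (T ^ m) ^ s - D k ^ s)          ≈⟨ zeroˡ _ ⟩
    0#                                        ∎

  evalVec : ∀ {d} → Vec (Fin r) d → Carrier
  evalVec []      = 0#
  evalVec (i ∷ v) = φ i + T * evalVec v

  evalVec-∷ʳ : ∀ {d} (v : Vec (Fin r) d) i → evalVec (v ∷ʳ i) ≈ evalVec v + φ i * T ^ d
  evalVec-∷ʳ []      i = solve 2 (λ c t → c :+ t :* con (+ 0) := con (+ 0) :+ c :* con (+ 1)) refl (φ i) T
  evalVec-∷ʳ (j ∷ v) i = trans (+-congˡ (*-congˡ (evalVec-∷ʳ v i)))
    (solve 5 (λ c t l d p → c :+ t :* (l :+ d :* p) := (c :+ t :* l) :+ d :* (t :* p)) refl _ _ _ _ _)

  -- A polynomial of degree at most d is α + a T^d with deg α < d. For fixed a, the product over α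
  -- is E_d(z - a T^d) = E_d(z) - a D_d by induction and linearity; the product over a is then the
  -- recursion, by `∏-φ`.
  ∏ᵥ-evalVec : ∀ d z → ∏ᵥ d (λ v → z - evalVec v) ≈ E d z
  ∏ᵥ-evalVec zero    z = solve 1 (λ z → z :- con (+ 0) := z) refl z
  ∏ᵥ-evalVec (suc d) z = begin
    ∏ᵥ (suc d) (λ v → z - evalVec v)
      ≈⟨ ∏ᵥ-∷ʳ d (λ v → z - evalVec v) ⟩
    ∏ᵥ d (λ v → ∏ (λ i → z - evalVec (v ∷ʳ i)))
      ≈⟨ ∏ᵥ-cong d (λ v → ∏-cong (λ i → trans (+-congˡ (-‿cong (evalVec-∷ʳ v i)))
           (solve 3 (λ z l m → z :- (l :+ m) := (z :- m) :- l) refl _ _ _))) ⟩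
    ∏ᵥ d (λ v → ∏ (λ i → (z - φ i * T ^ d) - evalVec v))
      ≈⟨ ∏ᵥ-swap d _ ⟩
    ∏ (λ i → ∏ᵥ d (λ v → (z - φ i * T ^ d) - evalVec v))
      ≈⟨ ∏-cong (λ i → trans (∏ᵥ-evalVec d _) (trans (E-minus-φ d i z _)
           (+-congˡ (-‿cong (*-congˡ (E-T^ d)))))) ⟩
    ∏ (λ i → E d z - φ i * D d)
      ≈⟨ ∏-φ _ _ ⟩
    E (suc d) z ∎

  -- Expansion of x^(r^n) and uniqueness of its coefficients.

  -- With the upper index written as `m + k`, no truncated subtraction appears; with the denominator
  -- multiplied out, no division does.
  module Expansion
    (D-cancel : ∀ k x y → D k * x ≈ D k * y → x ≈ y)
    (Q : ℕ → ℕ → Carrier)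
    (Q-def : ∀ m k → Q (m ℕ.+ k) k * (D k * D m ^ (r ℕ.^ k)) ≈ D (m ℕ.+ k))
    where

    D^-cancel : ∀ k n x y → D k ^ n * x ≈ D k ^ n * y → x ≈ y
    D^-cancel k zero    x y eq = trans (sym (*-identityˡ x)) (trans eq (*-identityˡ y))
    D^-cancel k (suc n) x y eq = D^-cancel k n x y (D-cancel k _ _
      (trans (sym (*-assoc _ _ _)) (trans eq (*-assoc _ _ _))))

    Q-n-n : ∀ n → Q n n ≈ 1#
    Q-n-n n = D-cancel n _ _ (begin
      D n * Q n n                             ≈⟨ solve 2 (λ d q → d :* q := q :* (d :* con (+ 1))) refl _ _ ⟩
      Q n n * (D n * 1#)                      ≈⟨ *-congˡ (*-congˡ (trans (^-congˡ (r ℕ.^ n) D₀) (1^n≈1 (r ℕ.^ n)))) ⟨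
      Q n n * (D n * D 0 ^ (r ℕ.^ n))         ≈⟨ Q-def 0 n ⟩
      D n                                     ≈⟨ *-identityʳ (D n) ⟨
      D n * 1#                                ∎)

    Q-n-0 : ∀ n → Q n 0 ≈ 1#
    Q-n-0 n = D-cancel n _ _ (begin
      D n * Q n 0                  ≈⟨ solve 2 (λ d q → d :* q := q :* (con (+ 1) :* (d :* con (+ 1)))) refl _ _ ⟩
      Q n 0 * (1# * (D n * 1#))    ≈⟨ *-congˡ (*-congʳ D₀) ⟨
      Q n 0 * (D 0 * (D n * 1#))   ≈⟨ ≡.subst (λ m → Q m 0 * (D 0 * (D n * 1#)) ≈ D m) (ℕP.+-identityʳ n) (Q-def n 0) ⟩
      D n                          ≈⟨ *-identityʳ (D n) ⟨
      D n * 1#                     ∎)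

    -- Multiplied by the denominator `d * X` of the left side, both sides become D_(n+1) = [n+1]
    -- D_n^r with n = m + 1 + k. Of the two parts of [n+1], the power of [m+1] completes the
    -- denominator of `Q n (suc k)` to `X`, and [k+1] turns D_k^r into `d`.
    Q-rec : ∀ m k → Q (suc (suc m ℕ.+ k)) (suc k) ≈
                    D (suc k) ^ s * Q (suc m ℕ.+ k) (suc k) ^ r + Q (suc m ℕ.+ k) k ^ r
    Q-rec m k = D-cancel (suc k) _ _ (D^-cancel (suc m) (r ℕ.^ suc k) _ _ (begin
      X * (d * Q (suc n) (suc k))
        ≈⟨ solve 3 (λ X d q → X :* (d :* q) := q :* (d :* X)) refl _ _ _ ⟩
      Q (suc n) (suc k) * (d * X)
        ≈⟨ ≡.subst (λ l → Q (suc l) (suc k) * (d * X) ≈ D (suc l)) (ℕP.+-suc m k) (Q-def (suc m) (suc k)) ⟩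
      D (suc n)
        ≈⟨ D₊ n ⟩
      br (suc n) * D n ^ r
        ≈⟨ *-congʳ br-split ⟩
      (br (suc m) ^ (r ℕ.^ suc k) + br (suc k)) * D n ^ r
        ≈⟨ solve 3 (λ a b e → (a :+ b) :* e := a :* e :+ b :* e) refl _ _ _ ⟩
      br (suc m) ^ (r ℕ.^ suc k) * D n ^ r + br (suc k) * D n ^ r
        ≈⟨ +-cong (*-congˡ P-eq) (*-congˡ W-eq) ⟨
      br (suc m) ^ (r ℕ.^ suc k) * (P ^ r * (d * d ^ s * Y)) + br (suc k) * (W ^ r * (D k ^ r * X))
        ≈⟨ +-cong (solve 5 (λ a p d e y → a :* (p :* (d :* e :* y)) := (a :* y) :* (d :* (e :* p))) refl _ _ _ _ _)
                  (solve 4 (λ b w d x → b :* (w :* (d :* x)) := x :* ((b :* d) :* w)) refl _ _ _ _) ⟩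
      (br (suc m) ^ (r ℕ.^ suc k) * Y) * (d * (d ^ s * P ^ r)) + X * ((br (suc k) * D k ^ r) * W ^ r)
        ≈⟨ +-cong (*-congʳ X-eq) (*-congˡ (*-congʳ (D₊ k))) ⟨
      X * (d * (d ^ s * P ^ r)) + X * (d * W ^ r)
        ≈⟨ solve 4 (λ x d a b → x :* (d :* a) :+ x :* (d :* b) := x :* (d :* (a :+ b))) refl _ _ _ _ ⟩
      X * (d * (d ^ s * P ^ r + W ^ r)) ∎))
      where
      n = suc m ℕ.+ k
      d = D (suc k)
      X = D (suc m) ^ (r ℕ.^ suc k)
      Y = (D m ^ (r ℕ.^ suc k)) ^ r
      P = Q n (suc k)
      W = Q n k

      X-eq : X ≈ br (suc m) ^ (r ℕ.^ suc k) * Y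
      X-eq = begin
        D (suc m) ^ (r ℕ.^ suc k)                               ≈⟨ ^-congˡ (r ℕ.^ suc k) (D₊ m) ⟩
        (br (suc m) * D m ^ r) ^ (r ℕ.^ suc k)                  ≈⟨ ^-distrib-* _ _ (r ℕ.^ suc k) ⟩
        br (suc m) ^ (r ℕ.^ suc k) * (D m ^ r) ^ (r ℕ.^ suc k)  ≈⟨ *-congˡ (^-swap (D m) r (r ℕ.^ suc k)) ⟩
        br (suc m) ^ (r ℕ.^ suc k) * Y                          ∎

      P-eq : P ^ r * (d * d ^ s * Y) ≈ D n ^ r
      P-eq = begin
        P ^ r * (d * d ^ s * Y)                      ≈⟨ *-congˡ (*-congʳ (^r-suc d)) ⟨
        P ^ r * (d ^ r * Y)                          ≈⟨ *-congˡ (^-distrib-* _ _ r) ⟨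
        P ^ r * (d * D m ^ (r ℕ.^ suc k)) ^ r        ≈⟨ ^-distrib-* _ _ r ⟨
        (P * (d * D m ^ (r ℕ.^ suc k))) ^ r          ≈⟨ ^-congˡ r (≡.subst (λ l → Q l (suc k) * (d * D m ^ (r ℕ.^ suc k)) ≈ D l)
                                                                 (ℕP.+-suc m k) (Q-def m (suc k))) ⟩
        D n ^ r                                      ∎

      W-eq : W ^ r * (D k ^ r * X) ≈ D n ^ r
      W-eq = begin
        W ^ r * (D k ^ r * X)                                ≈⟨ *-congˡ (*-congˡ (^r^-suc _ k)) ⟩
        W ^ r * (D k ^ r * (D (suc m) ^ (r ℕ.^ k)) ^ r)      ≈⟨ *-congˡ (^-distrib-* _ _ r) ⟨
        W ^ r * (D k * D (suc m) ^ (r ℕ.^ k)) ^ r            ≈⟨ ^-distrib-* _ _ r ⟨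
        (W * (D k * D (suc m) ^ (r ℕ.^ k))) ^ r              ≈⟨ ^-congˡ r (Q-def (suc m) k) ⟩
        D n ^ r                                              ∎

      -- The difference is split at `T ^ (r ^ suc k)`; since n + 1 = (m + 1) + (k + 1), the upper
      -- part is an iterated Frobenius image of `br (suc m)`.
      br-split : br (suc n) ≈ br (suc m) ^ (r ℕ.^ suc k) + br (suc k)
      br-split = begin
        T ^ (r ℕ.^ suc n) - T
          ≈⟨ solve 3 (λ a b t → a :- t := (a :- b) :+ (b :- t)) refl _ (T ^ (r ℕ.^ suc k)) T ⟩
        (T ^ (r ℕ.^ suc n) - T ^ (r ℕ.^ suc k)) + br (suc k)
          ≈⟨ +-congʳ (+-congʳ (^-congʳ T (≡.trans (≡.cong (λ l → r ℕ.^ suc l) (≡.sym (ℕP.+-suc m k)))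
                                                  (ℕP.^-distribˡ-+-* r (suc m) (suc k))))) ⟩
        (T ^ (r ℕ.^ suc m ℕ.* r ℕ.^ suc k) - T ^ (r ℕ.^ suc k)) + br (suc k)
          ≈⟨ +-congʳ (+-congʳ (^-assocʳ T (r ℕ.^ suc m) (r ℕ.^ suc k))) ⟨
        ((T ^ (r ℕ.^ suc m)) ^ (r ℕ.^ suc k) - T ^ (r ℕ.^ suc k)) + br (suc k)
          ≈⟨ +-congʳ (^r^-minus (suc k) _ _) ⟨
        br (suc m) ^ (r ℕ.^ suc k) + br (suc k) ∎

    E^r : ∀ k x → E k x ^ r ≈ E (suc k) x + D k ^ s * E k x
    E^r k x = solve 2 (λ a b → a := (a :- b) :+ b) refl _ _

    -- Each r-th power E_k^r spills an E_(k+1) into the next index. The last term is this unfinished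
    -- contribution; the next step joins it to D_(m+1)^(r-1) Q(n,m+1)^r, and `Q-rec` recognises the
    -- sum.
    partial : ∀ n x m → m ≤ n →
              sumTo m (λ k → (E k x * Q n k) ^ r) ≈
              sumTo m (λ k → E k x * Q (suc n) k) + E (suc m) x * Q n m ^ r
    partial n x zero    _ = begin
      (E 0 x * Q n 0) ^ r
        ≈⟨ ^-distrib-* _ _ r ⟩
      E 0 x ^ r * Q n 0 ^ r
        ≈⟨ *-cong (E^r 0 x) (Q^r n) ⟩
      (E 1 x + D 0 ^ s * E 0 x) * 1#
        ≈⟨ *-congʳ (+-congˡ (*-congʳ (trans (^-congˡ s D₀) (1^n≈1 s)))) ⟩
      (E 1 x + 1# * E 0 x) * 1#
        ≈⟨ solve 2 (λ a b → (a :+ con (+ 1) :* b) :* con (+ 1) := b :* con (+ 1) :+ a :* con (+ 1)) refl _ _ ⟩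
      E 0 x * 1# + E 1 x * 1#
        ≈⟨ +-cong (*-congˡ (Q-n-0 (suc n))) (*-congˡ (Q^r n)) ⟨
      E 0 x * Q (suc n) 0 + E 1 x * Q n 0 ^ r ∎
      where
      Q^r : ∀ n → Q n 0 ^ r ≈ 1#
      Q^r n = trans (^-congˡ r (Q-n-0 n)) (1^n≈1 r)
    partial n x (suc m) m<n = begin
      sumTo m (λ k → (E k x * Q n k) ^ r) + (E (suc m) x * Q n (suc m)) ^ r
        ≈⟨ +-cong (partial n x m (ℕP.<⇒≤ m<n)) (trans (^-distrib-* _ _ r) (*-congʳ (E^r (suc m) x))) ⟩
      (Σ' + E (suc m) x * Q n m ^ r) + (E (suc (suc m)) x + D (suc m) ^ s * E (suc m) x) * Q n (suc m) ^ r
        ≈⟨ solve 6 (λ S e q e' d p → (S :+ e :* q) :+ (e' :+ d :* e) :* p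
                      := (S :+ e :* (d :* p :+ q)) :+ e' :* p) refl _ _ _ _ _ _ ⟩
      (Σ' + E (suc m) x * (D (suc m) ^ s * Q n (suc m) ^ r + Q n m ^ r)) + E (suc (suc m)) x * Q n (suc m) ^ r
        ≈⟨ +-congʳ (+-congˡ (*-congˡ (≡.subst (λ l → Q (suc l) (suc m) ≈ D (suc m) ^ s * Q l (suc m) ^ r + Q l m ^ r)
             (≡.trans (≡.sym (ℕP.+-suc (n ℕ.∸ suc m) m)) (ℕP.m∸n+n≡m m<n)) (Q-rec (n ℕ.∸ suc m) m)))) ⟨
      (Σ' + E (suc m) x * Q (suc n) (suc m)) + E (suc (suc m)) x * Q n (suc m) ^ r ∎
      where Σ' = sumTo m (λ k → E k x * Q (suc n) k)

    sum-E-Q : ∀ n x → sumTo n (λ k → E k x * Q n k) ≈ x ^ (r ℕ.^ n)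
    sum-E-Q zero    x = *-congˡ (Q-n-0 0)
    sum-E-Q (suc n) x = begin
      sumTo n (λ k → E k x * Q (suc n) k) + E (suc n) x * Q (suc n) (suc n)
        -- Both diagonal coefficients are 1, so the top term is exactly the spilled term of
        -- `partial` at m = n.
        ≈⟨ +-congˡ (*-congˡ (trans (Q-n-n (suc n)) (sym (trans (^-congˡ r (Q-n-n n)) (1^n≈1 r))))) ⟩
      sumTo n (λ k → E k x * Q (suc n) k) + E (suc n) x * Q n n ^ r
        ≈⟨ partial n x n ℕP.≤-refl ⟨
      sumTo n (λ k → (E k x * Q n k) ^ r)
        ≈⟨ sumTo-additive (_^ r) ^r-+ n _ ⟨
      sumTo n (λ k → E k x * Q n k) ^ r
        ≈⟨ ^-congˡ r (sum-E-Q n x) ⟩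
      (x ^ (r ℕ.^ n)) ^ r
        ≈⟨ ^r^-suc x n ⟨
      x ^ (r ℕ.^ suc n) ∎

    -- The matrix `E k (T ^ j)` is triangular with cancellable diagonal `D j`: at `T ^ j` the terms
    -- below `j` vanish by induction, those above by `E-vanish`.
    E-independent : ∀ n (t : ℕ → Carrier) → (∀ x → sumTo n (λ k → E k x * t k) ≈ 0#) →
                    ∀ j → j ≤ n → t j ≈ 0#
    E-independent n t sum≈0 = <-rec (λ j → j ≤ n → t j ≈ 0#) step
      where
      step : ∀ j → (∀ {k} → k < j → k ≤ n → t k ≈ 0#) → j ≤ n → t j ≈ 0#
      step j rec j≤n = D-cancel j _ _ (begin
        D j * t j                           ≈⟨ *-congʳ (E-T^ j) ⟨
        E j (T ^ j) * t j                   ≈⟨ sumTo-single n j j≤n other ⟨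
        sumTo n (λ k → E k (T ^ j) * t k)   ≈⟨ sum≈0 (T ^ j) ⟩
        0#                                  ≈⟨ zeroʳ (D j) ⟨
        D j * 0#                            ∎)
        where
        other : ∀ k → k ≤ n → k ≢ j → E k (T ^ j) * t k ≈ 0#
        other k k≤n k≢j with k ℕ.<? j
        ... | yes k<j = trans (*-congˡ (rec k<j k≤n)) (zeroʳ _)
        ... | no  k≮j = trans (*-congʳ (E-vanish (ℕP.≤∧≢⇒< (ℕP.≮⇒≥ k≮j) (λ eq → k≢j (≡.sym eq))))) (zeroˡ _)

    stirling-unique : ∀ n (S : ℕ → Carrier) → (∀ x → sumTo n (λ k → E k x * S k) ≈ x ^ (r ℕ.^ n)) →
                      ∀ j → j ≤ n → S j ≈ Q n j
    stirling-unique n S S-sum j j≤n = x-y≈0⇒x≈y (E-independent n (λ k → S k - Q n k) (λ x → begin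
      sumTo n (λ k → E k x * (S k - Q n k))
        ≈⟨ sumTo-cong n (λ k _ → x[y-z]≈xy-xz _ _ _) ⟩
      sumTo n (λ k → E k x * S k - E k x * Q n k)
        ≈⟨ sumTo-minus n _ _ ⟩
      sumTo n (λ k → E k x * S k) - sumTo n (λ k → E k x * Q n k)
        ≈⟨ +-cong (S-sum x) (-‿cong (sum-E-Q n x)) ⟩
      x ^ (r ℕ.^ n) - x ^ (r ℕ.^ n)
        ≈⟨ -‿inverseʳ _ ⟩
      0# ∎) j j≤n)
      where
      x-y≈0⇒x≈y : ∀ {x y} → x - y ≈ 0# → x ≈ y
      x-y≈0⇒x≈y {x} {y} eq = x∙y⁻¹≈ε⇒x≈y x y eq

-- Finite fields and Fermat's theorem.

module FiniteField {c ℓ} (F : CommutativeRing c ℓ) (s : ℕ) (f : Fin (suc s) → CommutativeRing.Carrier F)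
  (isFF : IsFiniteField F (suc s) f) where
  open RingProperties F
  open IsFiniteField isFF public

  index : Carrier → Fin (suc s)
  index x = proj₁ (f-surj x)

  f-index : ∀ x → f (index x) ≈ x
  f-index x = proj₂ (f-surj x)

  index-f : ∀ {i x} → x ≈ f i → index x ≡ i
  index-f x≈fi = f-inj _ _ (trans (f-index _) x≈fi)

  infix 4 _≟_
  _≟_ : ∀ x y → Dec (x ≈ y)
  x ≟ y with index x Fin.≟ index y
  ... | yes eq = yes (trans (sym (f-index x)) (trans (reflexive (≡.cong f eq)) (f-index y)))
  ... | no neq = no (λ x≈y → neq (index-f (trans x≈y (sym (f-index y)))))

  integral : Integral
  integral x y xy≈0 x≉0 with inverse x x≉0
  ... | w , xw≈1 = begin
    y            ≈⟨ *-identityˡ y ⟨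
    1# * y       ≈⟨ *-congʳ xw≈1 ⟨
    x * w * y    ≈⟨ solve 3 (λ x w y → x :* w :* y := w :* (x :* y)) refl x w y ⟩
    w * (x * y)  ≈⟨ *-congˡ xy≈0 ⟩
    w * 0#       ≈⟨ zeroʳ w ⟩
    0#           ∎

  inducedPerm : (g h : Carrier → Carrier) → (∀ {x y} → x ≈ y → g x ≈ g y) → (∀ {x y} → x ≈ y → h x ≈ h y) →
                (∀ x → g (h x) ≈ x) → (∀ x → h (g x) ≈ x) → Permutation′ (suc s)
  inducedPerm g h g-cong h-cong gh hg = permutation (λ i → index (g (f i))) (λ i → index (h (f i)))
    (λ i → index-f (trans (g-cong (f-index _)) (gh (f i))))
    (λ i → index-f (trans (h-cong (f-index _)) (hg (f i))))

  ∏-nonzero : ∀ {n} (t : Fin n → Carrier) → (∀ i → ¬ (t i ≈ 0#)) → ¬ (∏ t ≈ 0#)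
  ∏-nonzero {zero}  t t≉0 = 1≉0
  ∏-nonzero {suc n} t t≉0 eq = ∏-nonzero (λ i → t (suc i)) (λ i → t≉0 (suc i)) (integral _ _ eq (t≉0 zero))

  -- The value 1 at zero makes products over F run over the nonzero elements only.
  nz : Carrier → Carrier → Carrier
  nz a x with x ≟ 0#
  ... | yes _ = 1#
  ... | no  _ = a

  -- For nonzero `a`, multiplication by `a` permutes F and fixes zero, so the product of the nonzero
  -- elements equals itself times a^(r-1), and cancels.
  fermat : ∀ a → a ^ suc s ≈ a
  fermat a with a ≟ 0#
  ... | yes a≈0 = trans (^-congˡ (suc s) a≈0) (trans (zeroˡ _) (sym a≈0))
  ... | no  a≉0 = trans (*-congˡ a^s≈1) (*-identityʳ a)
    where
    w = proj₁ (inverse a a≉0)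
    aw≈1 : a * w ≈ 1#
    aw≈1 = proj₂ (inverse a a≉0)

    σ : Permutation′ (suc s)
    σ = inducedPerm (a *_) (w *_) *-congˡ *-congˡ
      (λ x → trans (sym (*-assoc _ _ _)) (trans (*-congʳ aw≈1) (*-identityˡ x)))
      (λ x → trans (sym (*-assoc _ _ _)) (trans (*-congʳ (trans (*-comm _ _) aw≈1)) (*-identityˡ x)))

    G : Carrier → Carrier
    G x = nz x x

    -- At zero all three factors are 1, so the relation can be multiplied over the whole of F.
    G-scale : ∀ {x y} → y ≈ a * x → G y ≈ nz a x * G x
    G-scale {x} {y} y≈ax with x ≟ 0# | y ≟ 0#
    ... | yes x≈0 | yes y≈0 = sym (*-identityˡ 1#)
    ... | yes x≈0 | no  y≉0 = contradiction (trans y≈ax (trans (*-congˡ x≈0) (zeroʳ a))) y≉0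
    ... | no  x≉0 | yes y≈0 = contradiction (integral a x (trans (sym y≈ax) y≈0) a≉0) x≉0
    ... | no  x≉0 | no  y≉0 = y≈ax

    G-nonzero : ∀ x → ¬ (G x ≈ 0#)
    G-nonzero x with x ≟ 0#
    ... | yes _   = 1≉0
    ... | no  x≉0 = x≉0

    ∏G = ∏ (λ i → G (f i))

    ∏nz≈1 : ∏ (λ i → nz a (f i)) ≈ 1#
    ∏nz≈1 = x∙y⁻¹≈ε⇒x≈y _ _ (integral ∏G _ (begin
      ∏G * (∏ (λ i → nz a (f i)) - 1#)
        ≈⟨ solve 2 (λ g h → g :* (h :- con (+ 1)) := h :* g :- g) refl _ _ ⟩
      ∏ (λ i → nz a (f i)) * ∏G - ∏G
        ≈⟨ +-congʳ (∏-distrib-* (λ i → nz a (f i)) (λ i → G (f i))) ⟨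
      ∏ (λ i → nz a (f i) * G (f i)) - ∏G
        ≈⟨ +-congʳ (∏-cong (λ i → G-scale (f-index (a * f i)))) ⟨
      ∏ (λ i → G (f (index (a * f i)))) - ∏G
        ≈⟨ +-congʳ (∏-permute (λ i → G (f i)) σ) ⟨
      ∏G - ∏G
        ≈⟨ -‿inverseʳ _ ⟩
      0# ∎) (∏-nonzero _ (λ i → G-nonzero (f i))))

    i₀ = index 0#

    nz-0 : ∀ {x} → x ≈ 0# → nz a x ≈ 1#
    nz-0 {x} x≈0 with x ≟ 0#
    ... | yes _   = refl
    ... | no  x≉0 = contradiction x≈0 x≉0

    nz-≉0 : ∀ {x} → ¬ (x ≈ 0#) → nz a x ≈ a
    nz-≉0 {x} x≉0 with x ≟ 0#
    ... | yes x≈0 = contradiction x≈0 x≉0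
    ... | no  _   = refl

    a^s≈1 : a ^ s ≈ 1#
    -- Taking the index of zero out of the product leaves `s` factors, each equal to `a`.
    a^s≈1 = begin
      a ^ s
        ≈⟨ ∏-replicate s ⟨
      ∏ {s} (λ _ → a)
        ≈⟨ ∏-cong (λ i → nz-≉0 (λ eq → FinP.punchInᵢ≢i i₀ i (f-inj _ _ (trans eq (sym (f-index 0#)))))) ⟨
      ∏ (λ i → nz a (f (Fin.punchIn i₀ i)))
        ≈⟨ *-identityˡ _ ⟨
      1# * ∏ (λ i → nz a (f (Fin.punchIn i₀ i)))
        ≈⟨ *-congʳ (nz-0 (f-index 0#)) ⟨
      nz a (f i₀) * ∏ (λ i → nz a (f (Fin.punchIn i₀ i)))
        ≈⟨ ∏-remove {i = i₀} (λ i → nz a (f i)) ⟨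
      ∏ (λ i → nz a (f i))
        ≈⟨ ∏nz≈1 ⟩
      1# ∎

-- Factorisation of binary forms.

-- monic v is the homogeneous form y^m p(x/y), where p is the monic polynomial of degree m
-- whose lower coefficients are listed by v, constant term first.
module HomogeneousForms {c ℓ c′ ℓ′} (F : CommutativeRing c ℓ) (R : CommutativeRing c′ ℓ′)
  (φ : CommutativeRing.Carrier F → CommutativeRing.Carrier R)
  (φ-homo : RingMorphisms.IsRingHomomorphism (CommutativeRing.rawRing F) (CommutativeRing.rawRing R) φ) where
  private module F = RingProperties F
  open RingProperties R
  open RingMorphisms.IsRingHomomorphism φ-homo using ()
    renaming (⟦⟧-cong to φ-cong; +-homo to φ-+; *-homo to φ-*; 0#-homo to φ-0; 1#-homo to φ-1)

  monic : ∀ {m} → Vec F.Carrier m → Carrier → Carrier → Carrier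
  monic []              x y = 1#
  monic {suc m} (a ∷ v) x y = φ a * y ^ suc m + x * monic v x y

  eval : ∀ {m} → Vec F.Carrier m → F.Carrier → F.Carrier
  eval []      x = F.1#
  eval (a ∷ v) x = a F.+ x F.* eval v x

  -- Synthetic division by x - b: the Horner values of the tails at `b` are the coefficients, and
  -- `eval v b` is the remainder.
  quotient : ∀ {m} → Vec F.Carrier (suc m) → F.Carrier → Vec F.Carrier m
  quotient (a ∷ [])    b = []
  quotient (a ∷ v@(_ ∷ _)) b = eval v b ∷ quotient v b

  monic-quotient : ∀ {m} (v : Vec F.Carrier (suc m)) b x y →
    monic v x y ≈ (x - φ b * y) * monic (quotient v b) x y + φ (eval v b) * y ^ suc m
  monic-quotient (a ∷ []) b x y = begin
    φ a * (y * 1#) + x * 1#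
      ≈⟨ solve 4 (λ a b x y → a :* (y :* con (+ 1)) :+ x :* con (+ 1)
           := (x :- b :* y) :* con (+ 1) :+ (a :+ b :* con (+ 1)) :* (y :* con (+ 1))) refl _ (φ b) x y ⟩
    (x - φ b * y) * 1# + (φ a + φ b * 1#) * (y * 1#)
      ≈⟨ +-congˡ (*-congʳ (trans (φ-+ _ _) (+-congˡ (trans (φ-* _ _) (*-congˡ φ-1))))) ⟨
    (x - φ b * y) * 1# + φ (a F.+ b F.* F.1#) * (y * 1#) ∎
  monic-quotient {suc m} (a ∷ v@(_ ∷ _)) b x y = begin
    φ a * (y * Y) + x * monic v x y
      ≈⟨ +-congˡ (*-congˡ (monic-quotient v b x y)) ⟩
    φ a * (y * Y) + x * ((x - φ b * y) * q + φ (eval v b) * Y)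
      ≈⟨ solve 7 (λ a b x y Y q e → a :* (y :* Y) :+ x :* ((x :- b :* y) :* q :+ e :* Y)
           := (x :- b :* y) :* (e :* Y :+ x :* q) :+ (a :+ b :* e) :* (y :* Y)) refl _ _ _ _ _ _ _ ⟩
    (x - φ b * y) * (φ (eval v b) * Y + x * q) + (φ a + φ b * φ (eval v b)) * (y * Y)
      ≈⟨ +-congˡ (*-congʳ (trans (φ-+ _ _) (+-congˡ (φ-* _ _)))) ⟨
    (x - φ b * y) * (φ (eval v b) * Y + x * q) + φ (a F.+ b F.* eval v b) * (y * Y) ∎
    where
    Y = y ^ suc m
    q = monic (quotient v b) x y

  eval-quotient : ∀ {m} (v : Vec F.Carrier (suc m)) b x →
    eval v x F.≈ (x F.- b) F.* eval (quotient v b) x F.+ eval v b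
  eval-quotient (a ∷ []) b x = F.solve 3 (λ a b x → a F.:+ x F.:* F.con (+ 1)
    F.:= (x F.:- b) F.:* F.con (+ 1) F.:+ (a F.:+ b F.:* F.con (+ 1))) F.refl a b x
  eval-quotient (a ∷ v@(_ ∷ _)) b x = F.trans (F.+-congˡ (F.*-congˡ (eval-quotient v b x)))
    (F.solve 5 (λ a b x q e → a F.:+ x F.:* ((x F.:- b) F.:* q F.:+ e)
      F.:= (x F.:- b) F.:* (e F.:+ x F.:* q) F.:+ (a F.:+ b F.:* e)) F.refl _ _ _ _ _)

  -- Dividing by the factor of one root leaves the others as roots of the quotient, by integrality
  -- and distinctness in F. Coefficients and roots stay in F, so the factorisation passes to any
  -- F-algebra R.
  monic-roots : F.Integral → ∀ {m} (v : Vec F.Carrier m) (b : Fin m → F.Carrier) → (∀ i j → b i F.≈ b j → i ≡ j) →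
    (∀ i → eval v (b i) F.≈ F.0#) → ∀ x y → monic v x y ≈ ∏ (λ i → x - φ (b i) * y)
  monic-roots integral []            b b-inj root x y = refl
  monic-roots integral {suc m} v@(_ ∷ _) b b-inj root x y = begin
    monic v x y
      ≈⟨ monic-quotient v (b zero) x y ⟩
    (x - φ (b zero) * y) * monic (quotient v (b zero)) x y + φ (eval v (b zero)) * y ^ suc m
      ≈⟨ +-cong (*-congˡ (monic-roots integral (quotient v (b zero)) (λ i → b (suc i))
                  (λ i j eq → FinP.suc-injective (b-inj _ _ eq)) root′ x y))
                (trans (*-congʳ (trans (φ-cong (root zero)) φ-0)) (zeroˡ _)) ⟩
    (x - φ (b zero) * y) * ∏ (λ i → x - φ (b (suc i)) * y) + 0#
      ≈⟨ +-identityʳ _ ⟩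
    (x - φ (b zero) * y) * ∏ (λ i → x - φ (b (suc i)) * y) ∎
    where
    root′ : ∀ i → eval (quotient v (b zero)) (b (suc i)) F.≈ F.0#
    root′ i = integral (b (suc i) F.- b zero) _
      (F.trans (F.sym (F.+-identityʳ _)) (F.trans (F.+-congˡ (F.sym (root zero)))
        (F.trans (F.sym (eval-quotient v (b zero) (b (suc i)))) (root (suc i)))))
      (λ eq → FinP.0≢1+n (≡.sym (b-inj _ _ (F.x∙y⁻¹≈ε⇒x≈y _ _ eq))))

  monic-zeros : ∀ m x y → monic (replicate m F.0#) x y ≈ x ^ m
  monic-zeros zero    x y = refl
  monic-zeros (suc m) x y = trans (+-cong (trans (*-congʳ φ-0) (zeroˡ _)) (*-congˡ (monic-zeros m x y))) (+-identityˡ _)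

  eval-zeros : ∀ m x → eval (replicate m F.0#) x F.≈ x F.^ m
  eval-zeros zero    x = F.refl
  eval-zeros (suc m) x = F.trans (F.+-identityˡ _) (F.*-congˡ (eval-zeros m x))

-- The product formula over F and additivity of the r-th power.

module FrobeniusIdentities {c ℓ c′ ℓ′} (F : CommutativeRing c ℓ) (R : CommutativeRing c′ ℓ′)
  (φ : CommutativeRing.Carrier F → CommutativeRing.Carrier R)
  (φ-homo : RingMorphisms.IsRingHomomorphism (CommutativeRing.rawRing F) (CommutativeRing.rawRing R) φ)
  (s : ℕ) (f : Fin (suc (suc s)) → CommutativeRing.Carrier F) (isFF : IsFiniteField F (suc (suc s)) f) where
  private module F = RingProperties F
  open FiniteField F (suc s) f isFF
  open RingProperties R
  open HomogeneousForms F R φ φ-homo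
  open RingMorphisms.IsRingHomomorphism φ-homo using ()
    renaming (⟦⟧-cong to φ-cong; +-homo to φ-+; 0#-homo to φ-0; 1#-homo to φ-1; -‿homo to φ-neg; *-homo to φ-*)
  private
    r : ℕ
    r = suc (suc s)

    -- The polynomial x^r - x, whose r roots are all the elements of F. Listing its coefficients 0
    -- and -1 separately requires r to be at least 2.
    fermatPoly : Vec F.Carrier r
    fermatPoly = F.0# ∷ F.- F.1# ∷ replicate s F.0#

  ∏-field : ∀ x y → ∏ (λ i → x - φ (f i) * y) ≈ x ^ r - y ^ suc s * x
  ∏-field x y = begin
    ∏ (λ i → x - φ (f i) * y)
      ≈⟨ monic-roots integral fermatPoly f f-inj root x y ⟨
    φ F.0# * y ^ r + x * (φ (F.- F.1#) * y ^ suc s + x * monic (replicate s F.0#) x y)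
      ≈⟨ +-cong (trans (*-congʳ φ-0) (zeroˡ _)) (*-congˡ (+-cong (*-congʳ (trans (φ-neg _) (-‿cong φ-1)))
           (*-congˡ (monic-zeros s x y)))) ⟩
    0# + x * (- 1# * y ^ suc s + x * x ^ s)
      ≈⟨ solve 3 (λ x Y X → con (+ 0) :+ x :* (:- con (+ 1) :* Y :+ x :* X) := x :* (x :* X) :- Y :* x) refl _ _ _ ⟩
    x ^ r - y ^ suc s * x ∎
    where
    root : ∀ i → eval fermatPoly (f i) F.≈ F.0#
    root i = F.begin
      F.0# F.+ a F.* (F.- F.1# F.+ a F.* eval (replicate s F.0#) a)
        F.≈⟨ F.+-congˡ (F.*-congˡ (F.+-congˡ (F.*-congˡ (eval-zeros s a)))) ⟩
      F.0# F.+ a F.* (F.- F.1# F.+ a F.* a F.^ s)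
        F.≈⟨ F.solve 2 (λ a A → F.con (+ 0) F.:+ a F.:* (F.:- F.con (+ 1) F.:+ A) F.:= a F.:* A F.:- a) F.refl _ _ ⟩
      a F.^ r F.- a
        F.≈⟨ F.+-congʳ (fermat a) ⟩
      a F.- a
        F.≈⟨ F.-‿inverseʳ a ⟩
      F.0# F.∎
      where a = f i

  -- The product ∏ (x - a y) over a in F is invariant under x ↦ x + y.
  ^r-+ : ∀ x y → (x + y) ^ r ≈ x ^ r + y ^ r
  ^r-+ x y = begin
    (x + y) ^ r
      ≈⟨ solve 2 (λ a b → a := (a :- b) :+ b) refl _ (y ^ suc s * (x + y)) ⟩
    ((x + y) ^ r - y ^ suc s * (x + y)) + y ^ suc s * (x + y)
      ≈⟨ +-congʳ (∏-field (x + y) y) ⟨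
    ∏ (λ i → (x + y) - φ (f i) * y) + y ^ suc s * (x + y)
      ≈⟨ +-congʳ (∏-cong shift) ⟩
    ∏ (λ i → x - φ (f (index (f i F.- F.1#))) * y) + y ^ suc s * (x + y)
      ≈⟨ +-congʳ (∏-permute (λ i → x - φ (f i) * y) σ) ⟨
    ∏ (λ i → x - φ (f i) * y) + y ^ suc s * (x + y)
      ≈⟨ +-congʳ (∏-field x y) ⟩
    (x ^ r - y ^ suc s * x) + y ^ suc s * (x + y)
      ≈⟨ solve 4 (λ X Y x y → (X :- Y :* x) :+ Y :* (x :+ y) := X :+ y :* Y) refl _ _ x y ⟩
    x ^ r + y ^ r ∎
    where
    σ : Permutation′ r
    σ = inducedPerm (F._- F.1#) (F._+ F.1#) F.+-congʳ F.+-congʳ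
      (λ x → F.solve 1 (λ x → (x F.:+ F.con (+ 1)) F.:- F.con (+ 1) F.:= x) F.refl x)
      (λ x → F.solve 1 (λ x → (x F.:- F.con (+ 1)) F.:+ F.con (+ 1) F.:= x) F.refl x)
    shift : ∀ i → (x + y) - φ (f i) * y ≈ x - φ (f (index (f i F.- F.1#))) * y
    shift i = begin
      (x + y) - φ (f i) * y
        ≈⟨ solve 3 (λ x y a → (x :+ y) :- a :* y := x :- (a :- con (+ 1)) :* y) refl x y _ ⟩
      x - (φ (f i) - 1#) * y
        ≈⟨ +-congˡ (-‿cong (*-congʳ (trans (φ-cong (f-index _)) (trans (φ-+ _ _)
             (+-congˡ (trans (φ-neg _) (-‿cong φ-1))))))) ⟨
      x - φ (f (index (f i F.- F.1#))) * y ∎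

  φ^r : ∀ a → φ a ^ r ≈ φ a
  φ^r a = trans (sym (φ-^ r)) (φ-cong (fermat a))
    where
    φ-^ : ∀ n → φ (a F.^ n) ≈ φ a ^ n
    φ-^ zero    = φ-1
    φ-^ (suc n) = trans (φ-* _ _) (*-congˡ (φ-^ n))

-- Polynomials as coefficient lists: ring laws and integrality.

module PolynomialRing {c ℓ} (F : CommutativeRing c ℓ) where
  open RingProperties F
  open PolyOps rawRing public renaming (_+P_ to infixl 6 _+P_; _*P_ to infixl 7 _*P_)

  -- A wrapper around _≈P_ from which the polynomials can be inferred.
  record _≋_ (p q : Poly) : Set ℓ where
    constructor wrap
    field unwrap : p ≈P q
  open _≋_ public

  infix  4 _≋_

  ≋-refl : ∀ {p} → p ≋ p
  ≋-refl = wrap (λ _ → refl)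

  ≋-sym : ∀ {p q} → p ≋ q → q ≋ p
  ≋-sym e = wrap (λ i → sym (unwrap e i))

  ≋-trans : ∀ {p q r} → p ≋ q → q ≋ r → p ≋ r
  ≋-trans e e′ = wrap (λ i → trans (unwrap e i) (unwrap e′ i))

  ≋-setoid : Setoid c ℓ
  ≋-setoid = record { Carrier = Poly ; _≈_ = _≋_
    ; isEquivalence = record { refl = ≋-refl ; sym = ≋-sym ; trans = ≋-trans } }

  private module P = Relation.Binary.Reasoning.Setoid ≋-setoid

  ∷-cong : ∀ {a b p q} → a ≈ b → p ≋ q → a ∷ p ≋ b ∷ q
  ∷-cong a≈b p≋q = wrap (λ { zero → a≈b ; (suc i) → unwrap p≋q i })

  0∷[]≋[] : 0# ∷ [] ≋ []
  0∷[]≋[] = wrap (λ { zero → refl ; (suc i) → refl })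

  coeff-+ : ∀ p q i → coeff (p +P q) i ≈ coeff p i + coeff q i
  coeff-+ []      q       i       = sym (+-identityˡ _)
  coeff-+ (a ∷ p) []      i       = sym (+-identityʳ _)
  coeff-+ (a ∷ p) (b ∷ q) zero    = refl
  coeff-+ (a ∷ p) (b ∷ q) (suc i) = coeff-+ p q i

  coeff-scale : ∀ a p i → coeff (scale a p) i ≈ a * coeff p i
  coeff-scale a []      i       = sym (zeroʳ a)
  coeff-scale a (b ∷ p) zero    = refl
  coeff-scale a (b ∷ p) (suc i) = coeff-scale a p i

  coeff-neg : ∀ p i → coeff (negP p) i ≈ - coeff p i
  coeff-neg []      i       = sym -0#≈0#
  coeff-neg (b ∷ p) zero    = refl
  coeff-neg (b ∷ p) (suc i) = coeff-neg p i

  +P-cong : ∀ {p p′ q q′} → p ≋ p′ → q ≋ q′ → p +P q ≋ p′ +P q′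
  +P-cong {p} {p′} {q} {q′} e e′ = wrap (λ i →
    trans (coeff-+ p q i) (trans (+-cong (unwrap e i) (unwrap e′ i)) (sym (coeff-+ p′ q′ i))))

  +P-congˡ : ∀ p {q q′} → q ≋ q′ → p +P q ≋ p +P q′
  +P-congˡ p = +P-cong (≋-refl {p})

  +P-congʳ : ∀ {p p′} q → p ≋ p′ → p +P q ≋ p′ +P q
  +P-congʳ q e = +P-cong e (≋-refl {q})

  +P-assoc : ∀ p q r → (p +P q) +P r ≋ p +P (q +P r)
  +P-assoc p q r = wrap (λ i → begin
    coeff ((p +P q) +P r) i                ≈⟨ trans (coeff-+ (p +P q) r i) (+-congʳ (coeff-+ p q i)) ⟩
    coeff p i + coeff q i + coeff r i      ≈⟨ +-assoc _ _ _ ⟩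
    coeff p i + (coeff q i + coeff r i)    ≈⟨ trans (coeff-+ p (q +P r) i) (+-congˡ (coeff-+ q r i)) ⟨
    coeff (p +P (q +P r)) i                ∎)

  +P-comm : ∀ p q → p +P q ≋ q +P p
  +P-comm p q = wrap (λ i → trans (coeff-+ p q i) (trans (+-comm _ _) (sym (coeff-+ q p i))))

  +P-identityʳ : ∀ p → p +P [] ≋ p
  +P-identityʳ p = +P-comm p []

  negP-cong : ∀ {p q} → p ≋ q → negP p ≋ negP q
  negP-cong {p} {q} e = wrap (λ i → trans (coeff-neg p i) (trans (-‿cong (unwrap e i)) (sym (coeff-neg q i))))

  negP-inverseˡ : ∀ p → negP p +P p ≋ []
  negP-inverseˡ p = wrap (λ i →
    trans (coeff-+ (negP p) p i) (trans (+-congʳ (coeff-neg p i)) (-‿inverseˡ _)))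

  +P-interchange : ∀ p q r t → (p +P q) +P (r +P t) ≋ (p +P r) +P (q +P t)
  +P-interchange p q r t = P.begin
    (p +P q) +P (r +P t)   P.≈⟨ +P-assoc p q _ ⟩
    p +P (q +P (r +P t))   P.≈⟨ +P-congˡ p (≋-sym (+P-assoc q r t)) ⟩
    p +P ((q +P r) +P t)   P.≈⟨ +P-congˡ p (+P-congʳ t (+P-comm q r)) ⟩
    p +P ((r +P q) +P t)   P.≈⟨ +P-congˡ p (+P-assoc r q t) ⟩
    p +P (r +P (q +P t))   P.≈⟨ ≋-sym (+P-assoc p r _) ⟩
    (p +P r) +P (q +P t)   P.∎

  scale-cong : ∀ {a b p q} → a ≈ b → p ≋ q → scale a p ≋ scale b q
  scale-cong {a} {b} {p} {q} a≈b e = wrap (λ i →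
    trans (coeff-scale a p i) (trans (*-cong a≈b (unwrap e i)) (sym (coeff-scale b q i))))

  scale-0 : ∀ p → scale 0# p ≋ []
  scale-0 p = wrap (λ i → trans (coeff-scale 0# p i) (zeroˡ _))

  scale-1 : ∀ p → scale 1# p ≋ p
  scale-1 p = wrap (λ i → trans (coeff-scale 1# p i) (*-identityˡ _))

  scale-+P : ∀ a p q → scale a (p +P q) ≋ scale a p +P scale a q
  scale-+P a p q = wrap (λ i → begin
    coeff (scale a (p +P q)) i             ≈⟨ trans (coeff-scale a (p +P q) i) (*-congˡ (coeff-+ p q i)) ⟩
    a * (coeff p i + coeff q i)            ≈⟨ distribˡ _ _ _ ⟩
    a * coeff p i + a * coeff q i          ≈⟨ +-cong (coeff-scale a p i) (coeff-scale a q i) ⟨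
    coeff (scale a p) i + coeff (scale a q) i ≈⟨ coeff-+ (scale a p) (scale a q) i ⟨
    coeff (scale a p +P scale a q) i       ∎)

  +-scale : ∀ a b p → scale (a + b) p ≋ scale a p +P scale b p
  +-scale a b p = wrap (λ i → begin
    coeff (scale (a + b) p) i                 ≈⟨ trans (coeff-scale _ p i) (distribʳ _ _ _) ⟩
    a * coeff p i + b * coeff p i             ≈⟨ +-cong (coeff-scale a p i) (coeff-scale b p i) ⟨
    coeff (scale a p) i + coeff (scale b p) i ≈⟨ coeff-+ (scale a p) (scale b p) i ⟨
    coeff (scale a p +P scale b p) i          ∎)

  scale-scale : ∀ a b p → scale a (scale b p) ≋ scale (a * b) p
  scale-scale a b p = wrap (λ i → begin
    coeff (scale a (scale b p)) i   ≈⟨ trans (coeff-scale a (scale b p) i) (*-congˡ (coeff-scale b p i)) ⟩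
    a * (b * coeff p i)             ≈⟨ *-assoc _ _ _ ⟨
    a * b * coeff p i               ≈⟨ coeff-scale _ p i ⟨
    coeff (scale (a * b) p) i       ∎)

  shift-+P : ∀ p q → 0# ∷ (p +P q) ≋ (0# ∷ p) +P (0# ∷ q)
  shift-+P p q = ∷-cong (sym (+-identityˡ 0#)) ≋-refl

  *P-congˡ : ∀ p {q q′} → q ≋ q′ → p *P q ≋ p *P q′
  *P-congˡ []      e = ≋-refl
  *P-congˡ (a ∷ p) e = +P-cong (scale-cong refl e) (∷-cong refl (*P-congˡ p e))

  tail-≋ : ∀ {a b p q} → a ∷ p ≋ b ∷ q → p ≋ q
  tail-≋ e = wrap (λ i → unwrap e (suc i))

  tail-≋[] : ∀ {a p} → a ∷ p ≋ [] → p ≋ []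
  tail-≋[] e = wrap (λ i → unwrap e (suc i))

  -- A zero polynomial may be a nonempty list of zeros; congruence of the product needs this case
  -- when one list ends before the other.
  *P-zeroˡ : ∀ p q → p ≋ [] → p *P q ≋ []
  *P-zeroˡ []      q e = ≋-refl
  *P-zeroˡ (a ∷ p) q e = P.begin
    scale a q +P (0# ∷ p *P q)  P.≈⟨ +P-cong (scale-cong {p = q} (unwrap e 0) ≋-refl)
                                             (∷-cong refl (*P-zeroˡ p q (tail-≋[] e))) ⟩
    scale 0# q +P (0# ∷ [])     P.≈⟨ +P-cong (scale-0 q) 0∷[]≋[] ⟩
    []                          P.∎

  *P-congʳ : ∀ {p p′} q → p ≋ p′ → p *P q ≋ p′ *P q
  *P-congʳ {[]}    {p′}     q e = ≋-sym (*P-zeroˡ p′ q (≋-sym e))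
  *P-congʳ {a ∷ p} {[]}     q e = *P-zeroˡ (a ∷ p) q e
  *P-congʳ {a ∷ p} {b ∷ p′} q e =
    +P-cong (scale-cong {p = q} (unwrap e 0) ≋-refl) (∷-cong refl (*P-congʳ q (tail-≋ e)))

  *P-cong : ∀ {p p′ q q′} → p ≋ p′ → q ≋ q′ → p *P q ≋ p′ *P q′
  *P-cong {p} {p′} {q} {q′} e e′ = ≋-trans (*P-congˡ p e′) (*P-congʳ q′ e)

  *P-distribʳ : ∀ r p q → (p +P q) *P r ≋ p *P r +P q *P r
  *P-distribʳ r []      q       = ≋-refl
  *P-distribʳ r (a ∷ p) []      = ≋-sym (+P-identityʳ _)
  *P-distribʳ r (a ∷ p) (b ∷ q) = P.begin
    scale (a + b) r +P (0# ∷ (p +P q) *P r)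
      P.≈⟨ +P-cong (+-scale a b r) (≋-trans (∷-cong refl (*P-distribʳ r p q)) (shift-+P (p *P r) (q *P r))) ⟩
    (scale a r +P scale b r) +P ((0# ∷ p *P r) +P (0# ∷ q *P r))
      P.≈⟨ +P-interchange (scale a r) (scale b r) (0# ∷ p *P r) (0# ∷ q *P r) ⟩
    (scale a r +P (0# ∷ p *P r)) +P (scale b r +P (0# ∷ q *P r)) P.∎

  -- The product recurses on its left factor. This is the matching recursion on the right, which
  -- makes commutativity an induction.
  *P-∷ : ∀ p b q → p *P (b ∷ q) ≋ scale b p +P (0# ∷ p *P q)
  *P-∷ []      b q = ≋-sym 0∷[]≋[]
  *P-∷ (a ∷ p) b q = ∷-cong (+-congʳ (*-comm a b)) (P.begin
    scale a q +P p *P (b ∷ q)                   P.≈⟨ +P-congˡ (scale a q) (*P-∷ p b q) ⟩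
    scale a q +P (scale b p +P (0# ∷ p *P q))   P.≈⟨ ≋-sym (+P-assoc (scale a q) (scale b p) _) ⟩
    (scale a q +P scale b p) +P (0# ∷ p *P q)   P.≈⟨ +P-congʳ (0# ∷ p *P q) (+P-comm (scale a q) (scale b p)) ⟩
    (scale b p +P scale a q) +P (0# ∷ p *P q)   P.≈⟨ +P-assoc (scale b p) (scale a q) _ ⟩
    scale b p +P (scale a q +P (0# ∷ p *P q))   P.∎)

  *P-zeroʳ : ∀ p → p *P [] ≋ []
  *P-zeroʳ []      = ≋-refl
  *P-zeroʳ (a ∷ p) = ≋-trans (∷-cong refl (*P-zeroʳ p)) 0∷[]≋[]

  *P-comm : ∀ p q → p *P q ≋ q *P p
  *P-comm []      q = ≋-sym (*P-zeroʳ q)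
  *P-comm (a ∷ p) q = ≋-trans (+P-congˡ (scale a q) (∷-cong refl (*P-comm p q))) (≋-sym (*P-∷ q a p))

  scale-*P : ∀ a p q → scale a (p *P q) ≋ scale a p *P q
  scale-*P a []      q = ≋-refl
  scale-*P a (b ∷ p) q = ≋-trans (scale-+P a (scale b q) (0# ∷ p *P q))
    (+P-cong (scale-scale a b q) (∷-cong (zeroʳ a) (scale-*P a p q)))

  shift-*P : ∀ p q → (0# ∷ p) *P q ≋ 0# ∷ p *P q
  shift-*P p q = +P-congʳ (0# ∷ p *P q) (scale-0 q)

  *P-assoc : ∀ p q r → (p *P q) *P r ≋ p *P (q *P r)
  *P-assoc []      q r = ≋-refl
  *P-assoc (a ∷ p) q r = P.begin
    (scale a q +P (0# ∷ p *P q)) *P r          P.≈⟨ *P-distribʳ r (scale a q) (0# ∷ p *P q) ⟩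
    scale a q *P r +P (0# ∷ p *P q) *P r       P.≈⟨ +P-cong (≋-sym (scale-*P a q r)) (shift-*P (p *P q) r) ⟩
    scale a (q *P r) +P (0# ∷ (p *P q) *P r)   P.≈⟨ +P-congˡ (scale a (q *P r)) (∷-cong refl (*P-assoc p q r)) ⟩
    scale a (q *P r) +P (0# ∷ p *P (q *P r))   P.∎

  *P-identityˡ : ∀ p → (1# ∷ []) *P p ≋ p
  *P-identityˡ p = ≋-trans (+P-cong (scale-1 p) 0∷[]≋[]) (+P-identityʳ p)

  X*P : ∀ p → X *P p ≋ 0# ∷ p
  X*P p = ≋-trans (shift-*P (1# ∷ []) p) (∷-cong refl (*P-identityˡ p))

  polynomialRing : CommutativeRing c ℓ
  polynomialRing = record
    { Carrier = Poly ; _≈_ = _≈P_ ; _+_ = _+P_ ; _*_ = _*P_ ; -_ = negP ; 0# = [] ; 1# = 1# ∷ []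
    ; isCommutativeRing = record
      { isRing = record
        { +-isAbelianGroup = record
          { isGroup = record
            { isMonoid = record
              { isSemigroup = record
                { isMagma = record
                  { isEquivalence = record
                    { refl = λ _ → refl ; sym = λ e i → sym (e i) ; trans = λ e e′ i → trans (e i) (e′ i) }
                  ; ∙-cong = λ {p} {p′} {q} {q′} e e′ → unwrap (+P-cong {p} {p′} {q} {q′} (wrap e) (wrap e′)) }
                ; assoc = λ p q r → unwrap (+P-assoc p q r) }
              ; identity = (λ p i → refl) , λ p → unwrap (+P-identityʳ p) }
            ; inverse = (λ p → unwrap (negP-inverseˡ p)) ,
                        (λ p → unwrap (≋-trans (+P-comm p (negP p)) (negP-inverseˡ p)))
            ; ⁻¹-cong = λ {p} {q} e → unwrap (negP-cong {p} {q} (wrap e)) }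
          ; comm = λ p q → unwrap (+P-comm p q) }
        ; *-cong = λ {p} {p′} {q} {q′} e e′ → unwrap (*P-cong {p} {p′} {q} {q′} (wrap e) (wrap e′))
        ; *-assoc = λ p q r → unwrap (*P-assoc p q r)
        ; *-identity = (λ p → unwrap (*P-identityˡ p)) ,
                       (λ p → unwrap (≋-trans (*P-comm p _) (*P-identityˡ p)))
        ; distrib = (λ p q r → unwrap (≋-trans (*P-comm p (q +P r)) (≋-trans (*P-distribʳ p q r)
                      (+P-cong (*P-comm q p) (*P-comm r p))))) ,
                    (λ p q r → unwrap (*P-distribʳ p q r)) }
      ; *-comm = λ p q → unwrap (*P-comm p q) } }

  const-isHomomorphism : RingMorphisms.IsRingHomomorphism rawRing polyRawRing const
  const-isHomomorphism = record
    { isSemiringHomomorphism = record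
      { isNearSemiringHomomorphism = record
        { +-isMonoidHomomorphism = record
          { isMagmaHomomorphism = record
            { isRelHomomorphism = record { cong = λ e → unwrap (∷-cong e ≋-refl) }
            ; homo = λ a b i → refl }
          ; ε-homo = unwrap 0∷[]≋[] }
        ; *-homo = λ a b → unwrap (∷-cong (sym (+-identityʳ _)) ≋-refl) }
      ; 1#-homo = λ i → refl }
    ; -‿homo = λ a i → refl }

  module _ (_≟0 : ∀ a → Dec (a ≈ 0#)) (integral : Integral) where

    -- The constant coefficient of the product is `a * b`, so `b` vanishes; `q` then loses a factor
    -- X and the induction continues.
    *P-cancelˡ-const≉0 : ∀ a p → ¬ (a ≈ 0#) → ∀ q → (a ∷ p) *P q ≋ [] → q ≋ []
    *P-cancelˡ-const≉0 a p a≉0 []      e = ≋-refl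
    *P-cancelˡ-const≉0 a p a≉0 (b ∷ q) e = ≋-trans (∷-cong b≈0 q≋[]) 0∷[]≋[]
      where
      b≈0 : b ≈ 0#
      b≈0 = integral a b (trans (sym (+-identityʳ _)) (unwrap e 0)) a≉0
      q≋[] : q ≋ []
      q≋[] = *P-cancelˡ-const≉0 a p a≉0 q (wrap (λ i → trans (sym (unwrap (P.begin
        (a ∷ p) *P (b ∷ q)                    P.≈⟨ *P-congˡ (a ∷ p) (∷-cong {q = q} b≈0 ≋-refl) ⟩
        (a ∷ p) *P (0# ∷ q)                   P.≈⟨ *P-comm (a ∷ p) _ ⟩
        (0# ∷ q) *P (a ∷ p)                   P.≈⟨ shift-*P q (a ∷ p) ⟩
        0# ∷ q *P (a ∷ p)                     P.≈⟨ ∷-cong refl (*P-comm q (a ∷ p)) ⟩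
        0# ∷ (a ∷ p) *P q                     P.∎) (suc i))) (unwrap e (suc i))))

    -- Lowest nonzero coefficients take the place of leading ones, since trailing zeros hide the
    -- degree. The zero test strips factors X from `p` until its constant coefficient is nonzero.
    polynomial-integral : ∀ p q → (p *P q) ≈P [] → ¬ (p ≈P []) → q ≈P []
    polynomial-integral []      q e p≉0 = contradiction (λ _ → refl) p≉0
    polynomial-integral (a ∷ p) q e p≉0 with a ≟0
    ... | no  a≉0 = unwrap (*P-cancelˡ-const≉0 a p a≉0 q (wrap e))
    ... | yes a≈0 = polynomial-integral p q
      (λ i → trans (sym (unwrap (≋-trans (*P-congʳ q (∷-cong {q = p} a≈0 ≋-refl)) (shift-*P p q)) (suc i))) (e (suc i)))
      (λ p≈0 → p≉0 (unwrap (≋-trans (∷-cong a≈0 (wrap p≈0)) 0∷[]≋[])))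

-- Evaluation of polynomials at a point.

module PolynomialEvaluation {c ℓ} (R : CommutativeRing c ℓ) (x : CommutativeRing.Carrier R) where
  open RingProperties R
  open PolyOps rawRing
  private module PR = RawOps polyRawRing
  open RawOps rawRing using (prod; pow)

  ev : Poly → Carrier
  ev []      = 0#
  ev (a ∷ p) = a + x * ev p

  ev-zero : ∀ p → p ≈P [] → ev p ≈ 0#
  ev-zero []      e = refl
  ev-zero (a ∷ p) e = trans (+-cong (e 0) (trans (*-congˡ (ev-zero p (λ i → e (suc i)))) (zeroʳ x))) (+-identityˡ 0#)

  ev-cong : ∀ p q → p ≈P q → ev p ≈ ev q
  ev-cong []      q       e = sym (ev-zero q (λ i → sym (e i)))
  ev-cong (a ∷ p) []      e = ev-zero (a ∷ p) e
  ev-cong (a ∷ p) (b ∷ q) e = +-cong (e 0) (*-congˡ (ev-cong p q (λ i → e (suc i))))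

  ev-+ : ∀ p q → ev (p +P q) ≈ ev p + ev q
  ev-+ []      q       = sym (+-identityˡ _)
  ev-+ (a ∷ p) []      = sym (+-identityʳ _)
  ev-+ (a ∷ p) (b ∷ q) = trans (+-congˡ (*-congˡ (ev-+ p q)))
    (solve 5 (λ a b x p q → (a :+ b) :+ x :* (p :+ q) := (a :+ x :* p) :+ (b :+ x :* q)) refl _ _ _ _ _)

  ev-scale : ∀ a p → ev (scale a p) ≈ a * ev p
  ev-scale a []      = sym (zeroʳ a)
  ev-scale a (b ∷ p) = trans (+-congˡ (*-congˡ (ev-scale a p)))
    (solve 4 (λ a b x p → a :* b :+ x :* (a :* p) := a :* (b :+ x :* p)) refl _ _ _ _)

  ev-neg : ∀ p → ev (negP p) ≈ - ev p
  ev-neg []      = sym -0#≈0#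
  ev-neg (b ∷ p) = trans (+-congˡ (*-congˡ (ev-neg p)))
    (solve 3 (λ b x p → :- b :+ x :* :- p := :- (b :+ x :* p)) refl _ _ _)

  ev-* : ∀ p q → ev (p *P q) ≈ ev p * ev q
  ev-* []      q = sym (zeroˡ _)
  ev-* (a ∷ p) q = trans (ev-+ (scale a q) _) (trans (+-cong (ev-scale a q) (+-congˡ (*-congˡ (ev-* p q))))
    (solve 4 (λ a x p q → a :* q :+ (con (+ 0) :+ x :* (p :* q)) := (a :+ x :* p) :* q) refl _ _ _ _))

  ev-const : ∀ a → ev (const a) ≈ a
  ev-const a = trans (+-congˡ (zeroʳ x)) (+-identityʳ a)

  ev-X : ev X ≈ x
  ev-X = solve 1 (λ x → con (+ 0) :+ x :* (con (+ 1) :+ x :* con (+ 0)) := x) refl x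

  ev-pow : ∀ p n → ev (PR.pow p n) ≈ ev p ^ n
  ev-pow p zero    = ev-const 1#
  ev-pow p (suc n) = trans (ev-* p _) (*-congˡ (ev-pow p n))

  ev-prod : ∀ ps → ev (PR.prod ps) ≈ prod (List.map ev ps)
  ev-prod []       = ev-const 1#
  ev-prod (p ∷ ps) = trans (ev-* p _) (*-congˡ (ev-prod ps))

  ev-sumTo : ∀ n p → ev (PR.sumTo n p) ≈ sumTo n (λ k → ev (p k))
  ev-sumTo zero    p = refl
  ev-sumTo (suc n) p = trans (ev-+ (PR.sumTo n p) _) (+-congʳ (ev-sumTo n p))

-- The field of fractions of an integral domain.

module FractionField {c ℓ} (A : CommutativeRing c ℓ)
  (1≉0 : RingProperties.NonTrivial A) (integral : RingProperties.Integral A) where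
  open RingProperties A
  open FracOps rawRing public
  private module Raw = RawRing fracRawRing

  -- A nonzero denominator makes cross multiplication transitive. The operations on the underlying
  -- pairs are unchanged, so `proj₁` commutes with them definitionally.
  Fraction : Set (c ⊔ ℓ)
  Fraction = Σ Frac (λ x → ¬ (den x ≈ 0#))

  *-nonzero : ∀ {a b} → ¬ (a ≈ 0#) → ¬ (b ≈ 0#) → ¬ (a * b ≈ 0#)
  *-nonzero a≉0 b≉0 ab≈0 = b≉0 (integral _ _ ab≈0 a≉0)

  cancelˡ : ∀ a {x y} → ¬ (a ≈ 0#) → a * x ≈ a * y → x ≈ y
  cancelˡ a {x} {y} a≉0 eq = x∙y⁻¹≈ε⇒x≈y x y (integral a _ (begin
    a * (x - y)    ≈⟨ x[y-z]≈xy-xz a x y ⟩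
    a * x - a * y  ≈⟨ x≈y⇒x∙y⁻¹≈ε eq ⟩
    0#             ∎) a≉0)

  rawFractions : RawRing (c ⊔ ℓ) ℓ
  rawFractions = record
    { Carrier = Fraction
    ; _≈_ = λ x y → proj₁ x ≈F proj₁ y
    ; _+_ = λ x y → (proj₁ x Raw.+ proj₁ y) , *-nonzero (proj₂ x) (proj₂ y)
    ; _*_ = λ x y → (proj₁ x Raw.* proj₁ y) , *-nonzero (proj₂ x) (proj₂ y)
    ; -_  = λ x → (Raw.- proj₁ x) , proj₂ x
    ; 0#  = Raw.0# , 1≉0
    ; 1#  = Raw.1# , 1≉0 }

  ≈F-trans : ∀ (x y z : Fraction) → proj₁ x ≈F proj₁ y → proj₁ y ≈F proj₁ z → proj₁ x ≈F proj₁ z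
  ≈F-trans ((a , b) , _) ((a′ , b′) , b′≉0) ((a″ , b″) , _) e e′ = cancelˡ b′ b′≉0 (begin
    b′ * (a * b″)    ≈⟨ solve 3 (λ b′ a b″ → b′ :* (a :* b″) := a :* b′ :* b″) refl _ _ _ ⟩
    a * b′ * b″      ≈⟨ *-congʳ e ⟩
    a′ * b * b″      ≈⟨ solve 3 (λ a′ b b″ → a′ :* b :* b″ := a′ :* b″ :* b) refl _ _ _ ⟩
    a′ * b″ * b      ≈⟨ *-congʳ e′ ⟩
    a″ * b′ * b      ≈⟨ solve 3 (λ a″ b′ b → a″ :* b′ :* b := b′ :* (a″ :* b)) refl _ _ _ ⟩
    b′ * (a″ * b)    ∎)

  fractionField : CommutativeRing (c ⊔ ℓ) ℓ
  fractionField = record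
    { RawRing rawFractions
    ; isCommutativeRing = record
      { isRing = record
        { +-isAbelianGroup = record
          { isGroup = record
            { isMonoid = record
              { isSemigroup = record
                { isMagma = record
                  { isEquivalence = record
                    { refl = refl ; sym = sym ; trans = λ {x} {y} {z} → ≈F-trans x y z }
                  ; ∙-cong = λ {((a , b) , _)} {((a′ , b′) , _)} {((d , e) , _)} {((d′ , e′) , _)} p q → begin
                      (a * e + d * b) * (b′ * e′)
                        ≈⟨ solve 6 (λ a b b′ d e e′ → (a :* e :+ d :* b) :* (b′ :* e′)
                             := (a :* b′) :* (e :* e′) :+ (d :* e′) :* (b :* b′)) refl a b b′ d e e′ ⟩
                      (a * b′) * (e * e′) + (d * e′) * (b * b′)
                        ≈⟨ +-cong (*-congʳ p) (*-congʳ q) ⟩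
                      (a′ * b) * (e * e′) + (d′ * e) * (b * b′)
                        ≈⟨ solve 6 (λ a′ b b′ d′ e e′ → (a′ :* b) :* (e :* e′) :+ (d′ :* e) :* (b :* b′)
                             := (a′ :* e′ :+ d′ :* b′) :* (b :* e)) refl a′ b b′ d′ e e′ ⟩
                      (a′ * e′ + d′ * b′) * (b * e) ∎ }
                ; assoc = λ { ((a , b) , _) ((d , e) , _) ((g , h) , _) →
                    solve 6 (λ a b d e g h → ((a :* e :+ d :* b) :* h :+ g :* (b :* e)) :* (b :* (e :* h))
                      := (a :* (e :* h) :+ (d :* h :+ g :* e) :* b) :* (b :* e :* h)) refl a b d e g h } }
              ; identity = (λ { ((a , b) , _) → solve 2 (λ a b → (con (+ 0) :* b :+ a :* con (+ 1)) :* b := a :* (con (+ 1) :* b)) refl a b })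
                         , (λ { ((a , b) , _) → solve 2 (λ a b → (a :* con (+ 1) :+ con (+ 0) :* b) :* b := a :* (b :* con (+ 1))) refl a b }) }
            ; inverse = (λ { ((a , b) , _) → solve 2 (λ a b → (:- a :* b :+ a :* b) :* con (+ 1) := con (+ 0) :* (b :* b)) refl a b })
                      , (λ { ((a , b) , _) → solve 2 (λ a b → (a :* b :+ :- a :* b) :* con (+ 1) := con (+ 0) :* (b :* b)) refl a b })
            ; ⁻¹-cong = λ p → trans (sym (-‿distribˡ-* _ _)) (trans (-‿cong p) (-‿distribˡ-* _ _)) }
          ; comm = λ { ((a , b) , _) ((d , e) , _) →
              solve 4 (λ a b d e → (a :* e :+ d :* b) :* (e :* b) := (d :* b :+ a :* e) :* (b :* e)) refl a b d e } }
        ; *-cong = λ {((a , b) , _)} {((a′ , b′) , _)} {((d , e) , _)} {((d′ , e′) , _)} p q → begin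
            (a * d) * (b′ * e′)  ≈⟨ solve 4 (λ a d b′ e′ → (a :* d) :* (b′ :* e′) := (a :* b′) :* (d :* e′)) refl a d b′ e′ ⟩
            (a * b′) * (d * e′)  ≈⟨ *-cong p q ⟩
            (a′ * b) * (d′ * e)  ≈⟨ solve 4 (λ a d b′ e′ → (a :* b′) :* (d :* e′) := (a :* d) :* (b′ :* e′)) refl a′ d′ b e ⟩
            (a′ * d′) * (b * e)  ∎
        ; *-assoc = λ { ((a , b) , _) ((d , e) , _) ((g , h) , _) →
            solve 6 (λ a b d e g h → ((a :* d) :* g) :* (b :* (e :* h)) := (a :* (d :* g)) :* ((b :* e) :* h)) refl a b d e g h }
        ; *-identity = (λ { ((a , b) , _) → solve 2 (λ a b → (con (+ 1) :* a) :* b := a :* (con (+ 1) :* b)) refl a b })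
                     , (λ { ((a , b) , _) → solve 2 (λ a b → (a :* con (+ 1)) :* b := a :* (b :* con (+ 1))) refl a b })
        ; distrib = (λ { ((a , b) , _) ((d , e) , _) ((g , h) , _) →
              solve 6 (λ a b d e g h → (a :* (d :* h :+ g :* e)) :* ((b :* e) :* (b :* h))
                := ((a :* d) :* (b :* h) :+ (a :* g) :* (b :* e)) :* (b :* (e :* h))) refl a b d e g h })
                  , (λ { ((a , b) , _) ((d , e) , _) ((g , h) , _) →
              solve 6 (λ a b d e g h → ((d :* h :+ g :* e) :* a) :* ((e :* b) :* (h :* b))
                := ((d :* a) :* (h :* b) :+ (g :* a) :* (e :* b)) :* ((e :* h) :* b)) refl a b d e g h }) }
      ; *-comm = λ { ((a , b) , _) ((d , e) , _) →
          solve 4 (λ a b d e → (a :* d) :* (e :* b) := (d :* a) :* (b :* e)) refl a b d e } } }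

  private module K = RingProperties fractionField

  embed : Carrier → Fraction
  embed a = ι a , 1≉0

  embed-isHomomorphism : RingMorphisms.IsRingHomomorphism rawRing rawFractions embed
  embed-isHomomorphism = record
    { isSemiringHomomorphism = record
      { isNearSemiringHomomorphism = record
        { +-isMonoidHomomorphism = record
          { isMagmaHomomorphism = record
            { isRelHomomorphism = record { cong = *-congʳ }
            ; homo = λ a b → solve 2 (λ a b → (a :+ b) :* (con (+ 1) :* con (+ 1))
                := (a :* con (+ 1) :+ b :* con (+ 1)) :* con (+ 1)) refl a b }
          ; ε-homo = refl }
        ; *-homo = λ a b → solve 2 (λ a b → (a :* b) :* (con (+ 1) :* con (+ 1)) := (a :* b) :* con (+ 1)) refl a b }
      ; 1#-homo = refl }
    ; -‿homo = λ a → refl }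

  fraction-*-den : ∀ (x : Fraction) → (x K.* embed (den (proj₁ x))) K.≈ embed (num (proj₁ x))
  fraction-*-den ((a , b) , _) = solve 2 (λ a b → (a :* b) :* con (+ 1) := a :* (b :* con (+ 1))) refl a b

  embed-cancel : ∀ a (x y : Fraction) → ¬ (a ≈ 0#) → embed a K.* x K.≈ embed a K.* y → x K.≈ y
  embed-cancel a ((b , d) , _) ((b′ , d′) , _) a≉0 e = cancelˡ a a≉0 (begin
    a * (b * d′)           ≈⟨ solve 3 (λ a b d′ → a :* (b :* d′) := (a :* b) :* (con (+ 1) :* d′)) refl a b d′ ⟩
    (a * b) * (1# * d′)    ≈⟨ e ⟩
    (a * b′) * (1# * d)    ≈⟨ solve 3 (λ a b d′ → a :* (b :* d′) := (a :* b) :* (con (+ 1) :* d′)) refl a b′ d ⟨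
    a * (b′ * d)           ∎)

-- Powers and list products; the recursion for `D`.

module PowersInRawOps {c ℓ} (R : CommutativeRing c ℓ) where
  open RingProperties R
  open RawOps rawRing using (prod; pow)

  pow≡^ : ∀ x n → pow x n ≡ x ^ n
  pow≡^ x zero    = ≡.refl
  pow≡^ x (suc n) = ≡.cong (x *_) (pow≡^ x n)

  pow-one : ∀ {x} → pow x 1 ≈ x
  pow-one = *-identityʳ _

  prod-∷ʳ : ∀ xs x → prod (xs List.∷ʳ x) ≈ prod xs * x
  prod-∷ʳ []       y = trans (*-identityʳ y) (sym (*-identityˡ y))
  prod-∷ʳ (x ∷ xs) y = trans (*-congˡ (prod-∷ʳ xs y)) (sym (*-assoc _ _ _))

  prod-applyUpTo-^ : ∀ m n (g h : ℕ → Carrier) → (∀ i → i < n → h i ≈ g i ^ m) →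
    prod (List.applyUpTo h n) ≈ prod (List.applyUpTo g n) ^ m
  prod-applyUpTo-^ m zero    g h eq = sym (1^n≈1 m)
  prod-applyUpTo-^ m (suc n) g h eq = trans
    (*-cong (eq 0 (s≤s z≤n)) (prod-applyUpTo-^ m n (g ∘ suc) (h ∘ suc) (λ i i<n → eq (suc i) (s≤s i<n))))
    (sym (^-distrib-* _ _ m))

  -- For b = bracket, weights i lists the factors of D i.
  prod-weights-suc : ∀ r i (b : ℕ → Carrier) →
    let weights n = List.map (λ m → pow (b m) (r ℕ.^ (n ℕ.∸ m))) (List.map suc (List.upTo n)) in
    prod (weights (suc i)) ≈ b (suc i) * prod (weights i) ^ r
  prod-weights-suc r i b = begin
    prod (weights (suc i))
      ≡⟨ ≡.cong prod (weights≡ (suc i)) ⟩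
    prod (List.applyUpTo (w (suc i)) (suc i))
      ≡⟨ ≡.cong prod (ListP.applyUpTo-∷ʳ (w (suc i)) i) ⟨
    prod (List.applyUpTo (w (suc i)) i List.∷ʳ w (suc i) i)
      ≈⟨ prod-∷ʳ (List.applyUpTo (w (suc i)) i) _ ⟩
    prod (List.applyUpTo (w (suc i)) i) * w (suc i) i
      -- Passing from `i` to `suc i` multiplies every old exponent by `r`; the new last factor has
      -- exponent r^0.
      ≈⟨ *-cong (prod-applyUpTo-^ r i (w i) (w (suc i)) (λ m m<i → w-suc m m<i))
                (trans (reflexive (≡.cong (λ l → pow (b (suc i)) (r ℕ.^ l)) (ℕP.n∸n≡0 i))) pow-one) ⟩
    prod (List.applyUpTo (w i) i) ^ r * b (suc i)
      ≈⟨ *-comm _ _ ⟩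
    b (suc i) * prod (List.applyUpTo (w i) i) ^ r
      ≡⟨ ≡.cong (λ ws → b (suc i) * prod ws ^ r) (weights≡ i) ⟨
    b (suc i) * prod (weights i) ^ r ∎
    where
    weights : ℕ → List Carrier
    weights n = List.map (λ m → pow (b m) (r ℕ.^ (n ℕ.∸ m))) (List.map suc (List.upTo n))
    w : ℕ → ℕ → Carrier
    w n m = pow (b (suc m)) (r ℕ.^ (n ℕ.∸ suc m))
    weights≡ : ∀ n → weights n ≡ List.applyUpTo (w n) n
    weights≡ n = ≡.trans (≡.cong (List.map _) (ListP.map-upTo suc n)) (ListP.map-applyUpTo suc _ n)
    w-suc : ∀ m → m < i → w (suc i) m ≈ w i m ^ r
    w-suc m m<i = begin
      pow (b (suc m)) (r ℕ.^ (i ℕ.∸ m))                ≡⟨ pow≡^ _ (r ℕ.^ (i ℕ.∸ m)) ⟩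
      b (suc m) ^ (r ℕ.^ (i ℕ.∸ m))                    ≡⟨ ≡.cong (λ l → b (suc m) ^ (r ℕ.^ l)) (ℕP.+-∸-assoc 1 m<i) ⟩
      b (suc m) ^ (r ℕ.* r ℕ.^ (i ℕ.∸ suc m))          ≡⟨ ≡.cong (b (suc m) ^_) (ℕP.*-comm r _) ⟩
      b (suc m) ^ (r ℕ.^ (i ℕ.∸ suc m) ℕ.* r)          ≈⟨ ^-assocʳ _ (r ℕ.^ (i ℕ.∸ suc m)) r ⟨
      (b (suc m) ^ (r ℕ.^ (i ℕ.∸ suc m))) ^ r          ≡⟨ ≡.cong (_^ r) (pow≡^ _ (r ℕ.^ (i ℕ.∸ suc m))) ⟨
      w i m ^ r                                        ∎

-- Coefficientwise maps between polynomials.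

module PolynomialMap {a ℓ b ℓ′} (R : RawRing a ℓ) (S : RawRing b ℓ′)
  (π : RawRing.Carrier R → RawRing.Carrier S)
  (π-+ : ∀ x y → π (RawRing._+_ R x y) ≡ RawRing._+_ S (π x) (π y))
  (π-* : ∀ x y → π (RawRing._*_ R x y) ≡ RawRing._*_ S (π x) (π y))
  (π-neg : ∀ x → π (RawRing.-_ R x) ≡ RawRing.-_ S (π x))
  (π-0 : π (RawRing.0# R) ≡ RawRing.0# S)
  (π-1 : π (RawRing.1# R) ≡ RawRing.1# S) where
  private
    module PR = PolyOps R
    module PS = PolyOps S
    module OR = RawOps PR.polyRawRing
    module OS = RawOps PS.polyRawRing

  -- Its compatibilities are propositional equalities, because the target is a raw ring whose
  -- equality need not be transitive.
  mapP : PR.Poly → PS.Poly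
  mapP = List.map π

  coeff-mapP : ∀ p i → PS.coeff (mapP p) i ≡ π (PR.coeff p i)
  coeff-mapP []      i       = ≡.sym π-0
  coeff-mapP (x ∷ p) zero    = ≡.refl
  coeff-mapP (x ∷ p) (suc i) = coeff-mapP p i

  mapP-+ : ∀ p q → mapP (p PR.+P q) ≡ mapP p PS.+P mapP q
  mapP-+ []      q       = ≡.refl
  mapP-+ (x ∷ p) []      = ≡.refl
  mapP-+ (x ∷ p) (y ∷ q) = ≡.cong₂ _∷_ (π-+ x y) (mapP-+ p q)

  mapP-scale : ∀ x p → mapP (PR.scale x p) ≡ PS.scale (π x) (mapP p)
  mapP-scale x []      = ≡.refl
  mapP-scale x (y ∷ p) = ≡.cong₂ _∷_ (π-* x y) (mapP-scale x p)

  mapP-neg : ∀ p → mapP (PR.negP p) ≡ PS.negP (mapP p)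
  mapP-neg []      = ≡.refl
  mapP-neg (y ∷ p) = ≡.cong₂ _∷_ (π-neg y) (mapP-neg p)

  mapP-* : ∀ p q → mapP (p PR.*P q) ≡ mapP p PS.*P mapP q
  mapP-* []      q = ≡.refl
  mapP-* (x ∷ p) q = ≡.trans (mapP-+ (PR.scale x q) _)
    (≡.cong₂ PS._+P_ (mapP-scale x q) (≡.cong₂ _∷_ π-0 (mapP-* p q)))

  mapP-1 : mapP (PR.const (RawRing.1# R)) ≡ PS.const (RawRing.1# S)
  mapP-1 = ≡.cong (_∷ []) π-1

  mapP-prod : ∀ ps → mapP (OR.prod ps) ≡ OS.prod (List.map mapP ps)
  mapP-prod []       = mapP-1
  mapP-prod (p ∷ ps) = ≡.trans (mapP-* p _) (≡.cong (mapP p PS.*P_) (mapP-prod ps))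

  mapP-pow : ∀ p n → mapP (OR.pow p n) ≡ OS.pow (mapP p) n
  mapP-pow p zero    = mapP-1
  mapP-pow p (suc n) = ≡.trans (mapP-* p _) (≡.cong (mapP p PS.*P_) (mapP-pow p n))

  mapP-sumTo : ∀ n p q → (∀ k → k ≤ n → mapP (p k) ≡ q k) → mapP (OR.sumTo n p) ≡ OS.sumTo n q
  mapP-sumTo zero    p q eq = eq 0 z≤n
  mapP-sumTo (suc n) p q eq = ≡.trans (mapP-+ (OR.sumTo n p) _)
    (≡.cong₂ PS._+P_ (mapP-sumTo n p q (λ k k≤n → eq k (ℕP.m≤n⇒m≤1+n k≤n))) (eq (suc n) ℕP.≤-refl))

-- Brackets and `D` in F_r[T]: recursion and nonvanishing.

module CarlitzRing {c ℓ} (F : CommutativeRing c ℓ) (s : ℕ) (f : Fin (suc (suc s)) → CommutativeRing.Carrier F)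
  (isFF : IsFiniteField F (suc (suc s)) f) where
  r : ℕ
  r = suc (suc s)

  open Carlitz F r f
  private module F = RingProperties F
  open FiniteField F (suc s) f isFF
  open PolynomialRing F
  private
    module 𝔸P = PowersInRawOps polynomialRing

  open RingProperties polynomialRing using (_≈_; 0#; 1#; _*_; _^_; trans; sym)
  open RawOps 𝔸 using (pow)

  polynomial-1≉0 : RingProperties.NonTrivial polynomialRing
  polynomial-1≉0 eq = 1≉0 (eq 0)

  𝔸-integral : RingProperties.Integral polynomialRing
  𝔸-integral = polynomial-integral (_≟ F.0#) integral

  open FractionField polynomialRing polynomial-1≉0 𝔸-integral public

  ^-nonzero : ∀ p n → ¬ (p ≈ 0#) → ¬ (p ^ n ≈ 0#)
  ^-nonzero p zero    p≉0 = polynomial-1≉0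
  ^-nonzero p (suc n) p≉0 = *-nonzero {p} {p ^ n} p≉0 (^-nonzero p n p≉0)

  pow-nonzero : ∀ p n → ¬ (p ≈ 0#) → ¬ (pow p n ≈ 0#)
  pow-nonzero p n p≉0 = ≡.subst (λ q → ¬ (q ≈ 0#)) (≡.sym (𝔸P.pow≡^ p n)) (^-nonzero p n p≉0)

  D-suc : ∀ k → D (suc k) ≈ bracket (suc k) * D k ^ r
  D-suc k = 𝔸P.prod-weights-suc r k bracket

  coeff-T^ : ∀ {n} → 2 ≤ n → coeff (pow T n) 1 F.≈ F.0#
  coeff-T^ {suc (suc n)} (s≤s (s≤s _)) =
    unwrap (≋-trans (*P-congˡ T (X*P (pow T n))) (X*P (F.0# ∷ pow T n))) 1

  -- The coefficient of `T` is -1, because r^(k+1) is at least 2.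
  bracket-nonzero : ∀ k → ¬ (bracket (suc k) ≈ 0#)
  bracket-nonzero k eq = 1≉0 (F.-‿injective (F.begin
    F.- F.1#                                                F.≈⟨ F.+-identityˡ _ ⟨
    F.0# F.+ F.- F.1#                                       F.≈⟨ F.+-congʳ (coeff-T^ 2≤r^1+k) ⟨
    coeff (pow T (r ℕ.^ suc k)) 1 F.+ F.- F.1#              F.≈⟨ coeff-+ (pow T (r ℕ.^ suc k)) (negP T) 1 ⟨
    coeff (pow T (r ℕ.^ suc k) +P negP T) 1                 F.≈⟨ eq 1 ⟩
    F.0#                                                    F.≈⟨ F.-0#≈0# ⟨
    F.- F.0#                                                F.∎))
    where
    2≤r^1+k : 2 ≤ r ℕ.^ suc k
    2≤r^1+k = ℕP.*-mono-≤ {2} {r} {1} (s≤s (s≤s z≤n)) (ℕP.m^n>0 r k)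

  D-nonzero : ∀ k → ¬ (D k ≈ 0#)
  D-nonzero zero    = polynomial-1≉0
  D-nonzero (suc k) eq = *-nonzero {bracket (suc k)} {D k ^ r} (bracket-nonzero k)
    (^-nonzero (D k) r (D-nonzero k))
    (trans {bracket (suc k) * D k ^ r} {D (suc k)} {0#} (sym {D (suc k)} {bracket (suc k) * D k ^ r} (D-suc k)) eq)

  quotientD-nonzero : ∀ n k → ¬ (FK.den (quotientD n k) ≈ 0#)
  quotientD-nonzero n k = *-nonzero {D k} {pow (D (n ℕ.∸ k)) (r ℕ.^ k)} (D-nonzero k)
    (pow-nonzero (D (n ℕ.∸ k)) (r ℕ.^ k) (D-nonzero (n ℕ.∸ k)))

-- The Carlitz data in a ring receiving F_r[T], and evaluation of the defining identity.

module CarlitzAlgebra {c ℓ c′ ℓ′} (F : CommutativeRing c ℓ) (s : ℕ) (f : Fin (suc (suc s)) → CommutativeRing.Carrier F)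
  (isFF : IsFiniteField F (suc (suc s)) f)
  (L : CommutativeRing c′ ℓ′)
  (embed : PolyOps.Poly (CommutativeRing.rawRing F) → CommutativeRing.Carrier L)
  (embed-homo : RingMorphisms.IsRingHomomorphism (PolyOps.polyRawRing (CommutativeRing.rawRing F))
                  (CommutativeRing.rawRing L) embed) where
  open RingProperties L
  open CarlitzRing F s f isFF using (r; D-suc)
  open Carlitz F r f
  open RawOps 𝔸 using (pow)
  private
    module F = CommutativeRing F
    module 𝔸R = RingProperties (PolynomialRing.polynomialRing F)
    module PL = PolyOps rawRing
    module OL = RawOps PL.polyRawRing
  open PolynomialRing F using (const-isHomomorphism; unwrap; X*P; +P-congˡ; ≋-trans; ≋-sym; ∷-cong; ≋-refl)
  open RingMorphisms.IsRingHomomorphism embed-homo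
    using () renaming (⟦⟧-cong to embed-cong; +-homo to embed-+; *-homo to embed-*; -‿homo to embed-neg;
                       0#-homo to embed-0; 1#-homo to embed-1)

  φ : F.Carrier → Carrier
  φ a = embed (PA.const a)

  φ-homo : RingMorphisms.IsRingHomomorphism F.rawRing rawRing φ
  φ-homo = Composition.isRingHomomorphism trans const-isHomomorphism embed-homo

  embed-^ : ∀ p n → embed (p 𝔸R.^ n) ≈ embed p ^ n
  embed-^ p zero    = embed-1
  embed-^ p (suc n) = trans (embed-* p _) (*-congˡ (embed-^ p n))

  embed-pow : ∀ p n → embed (pow p n) ≈ embed p ^ n
  embed-pow p n = trans (reflexive (≡.cong embed (PowersInRawOps.pow≡^ (PolynomialRing.polynomialRing F) p n)))
    (embed-^ p n)

  embed-D₊ : ∀ k → embed (D (suc k)) ≈ (embed T ^ (r ℕ.^ suc k) - embed T) * embed (D k) ^ r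
  embed-D₊ k = begin
    embed (D (suc k))
      ≈⟨ embed-cong {D (suc k)} {bracket (suc k) 𝔸R.* D k 𝔸R.^ r} (D-suc k) ⟩
    embed (bracket (suc k) 𝔸R.* D k 𝔸R.^ r)
      ≈⟨ embed-* (bracket (suc k)) (D k 𝔸R.^ r) ⟩
    embed (bracket (suc k)) * embed (D k 𝔸R.^ r)
      ≈⟨ *-cong (trans (embed-+ (pow T (r ℕ.^ suc k)) (𝔸R.- T)) (+-cong (embed-pow T (r ℕ.^ suc k)) (embed-neg T)))
                (embed-^ (D k) r) ⟩
    (embed T ^ (r ℕ.^ suc k) - embed T) * embed (D k) ^ r ∎

  open FrobeniusIdentities F L φ φ-homo s f isFF

  carlitzData : CarlitzData L r (suc s)
  carlitzData = record
    { φ    = λ i → φ (f i)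
    ; ∏-φ  = ∏-field
    ; ^r-+ = ^r-+
    ; φ^r  = λ i → φ^r (f i)
    ; T    = embed T
    ; D    = λ k → embed (D k)
    ; D₀   = embed-1
    ; D₊   = embed-D₊
    }

  open CarlitzPolynomials L r (suc s) ≡.refl carlitzData public
  open VecProducts L r

  embed-toPoly : ∀ {d} (v : Vec (Fin r) d) → embed (toPoly v) ≈ evalVec v
  embed-toPoly []      = embed-0
  embed-toPoly (i ∷ v) = begin
    embed (f i ∷ toPoly v)
      ≈⟨ embed-cong {f i ∷ toPoly v} {PA.const (f i) 𝔸R.+ T 𝔸R.* toPoly v} (unwrap (≋-sym (≋-trans
           (+P-congˡ (PA.const (f i)) (X*P (toPoly v))) (∷-cong {q = toPoly v} (F.+-identityʳ (f i)) ≋-refl)))) ⟩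
    embed (PA.const (f i) 𝔸R.+ T 𝔸R.* toPoly v)
      ≈⟨ trans (embed-+ (PA.const (f i)) (T 𝔸R.* toPoly v)) (+-congˡ (embed-* T (toPoly v))) ⟩
    φ (f i) + embed T * embed (toPoly v)
      ≈⟨ +-congˡ (*-congˡ (embed-toPoly v)) ⟩
    evalVec (i ∷ v) ∎

  factor : PA.Poly → PL.Poly
  factor α = PL.X PL.+P PL.negP (PL.const (embed α))

  -- The polynomial e k of Defs, with coefficients in L instead of the raw ring of fractions.
  eL : ℕ → PL.Poly
  eL k = OL.prod (List.map factor (𝔸< k))

  module _ (x : Carrier) where
    open PolynomialEvaluation L x

    ev-factor : ∀ {d} (v : Vec (Fin r) d) → ev (factor (toPoly v)) ≈ x - evalVec v
    ev-factor v = trans (ev-+ PL.X (PL.negP (PL.const (embed (toPoly v)))))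
      (+-cong ev-X (trans (ev-neg (PL.const (embed (toPoly v))))
        (-‿cong (trans (ev-const (embed (toPoly v))) (embed-toPoly v)))))

    ev-eL : ∀ k → ev (eL k) ≈ E k x
    ev-eL k = begin
      ev (eL k)
        ≈⟨ ev-prod (List.map factor (𝔸< k)) ⟩
      RawOps.prod rawRing (List.map ev (List.map factor (𝔸< k)))
        ≡⟨ ≡.cong (RawOps.prod rawRing) (≡.trans (≡.sym (ListP.map-∘ (𝔸< k))) (≡.sym (ListP.map-∘ (allVecs r k)))) ⟩
      RawOps.prod rawRing (List.map (λ v → ev (factor (toPoly v))) (allVecs r k))
        ≈⟨ prod-allVecs k (λ v → ev (factor (toPoly v))) ⟩
      ∏ᵥ k (λ v → ev (factor (toPoly v)))
        ≈⟨ ∏ᵥ-cong k ev-factor ⟩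
      ∏ᵥ k (λ v → x - evalVec v)
        ≈⟨ ∏ᵥ-evalVec k x ⟩
      E k x ∎

    -- Turns the identity between polynomials over L into the family of its values, the form in
    -- which uniqueness is proved.
    ev-expansion : ∀ n (S : ℕ → Carrier) →
      OL.sumTo n (λ k → eL k PL.*P PL.const (S k)) PL.≈P OL.pow PL.X (r ℕ.^ n) →
      sumTo n (λ k → E k x * S k) ≈ x ^ (r ℕ.^ n)
    ev-expansion n S eq = begin
      sumTo n (λ k → E k x * S k)
        ≈⟨ sumTo-cong n (λ k _ → trans (ev-* (eL k) (PL.const (S k))) (*-cong (ev-eL k) (ev-const (S k)))) ⟨
      sumTo n (λ k → ev (eL k PL.*P PL.const (S k)))
        ≈⟨ ev-sumTo n (λ k → eL k PL.*P PL.const (S k)) ⟨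
      ev (OL.sumTo n (λ k → eL k PL.*P PL.const (S k)))
        ≈⟨ ev-cong (OL.sumTo n (λ k → eL k PL.*P PL.const (S k))) (OL.pow PL.X (r ℕ.^ n)) eq ⟩
      ev (OL.pow PL.X (r ℕ.^ n))
        ≈⟨ ev-pow PL.X (r ℕ.^ n) ⟩
      ev PL.X ^ (r ℕ.^ n)
        ≈⟨ ^-congˡ (r ℕ.^ n) ev-X ⟩
      x ^ (r ℕ.^ n) ∎

  module _
    (D-cancel : ∀ k x y → embed (D k) * x ≈ embed (D k) * y → x ≈ y)
    (Q : ℕ → ℕ → Carrier)
    (Q-def : ∀ n k → Q n k * embed (FK.den (quotientD n k)) ≈ embed (D n))
    where

    Q-den : ∀ m k → Q (m ℕ.+ k) k * (embed (D k) * embed (D m) ^ (r ℕ.^ k)) ≈ embed (D (m ℕ.+ k))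
    Q-den m k = begin
      Q (m ℕ.+ k) k * (embed (D k) * embed (D m) ^ (r ℕ.^ k))
        ≈⟨ *-congˡ (trans (embed-* (D k) (pow (D m) (r ℕ.^ k))) (*-congˡ (embed-pow (D m) (r ℕ.^ k)))) ⟨
      Q (m ℕ.+ k) k * embed (D k 𝔸R.* pow (D m) (r ℕ.^ k))
        ≡⟨ ≡.cong (λ l → Q (m ℕ.+ k) k * embed (D k 𝔸R.* pow (D l) (r ℕ.^ k))) (ℕP.m+n∸n≡m m k) ⟨
      Q (m ℕ.+ k) k * embed (FK.den (quotientD (m ℕ.+ k) k))
        ≈⟨ Q-def (m ℕ.+ k) k ⟩
      embed (D (m ℕ.+ k)) ∎

    open Expansion D-cancel Q Q-den

    stirling-unique-eL : ∀ n (S : ℕ → Carrier) →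
      OL.sumTo n (λ k → eL k PL.*P PL.const (S k)) PL.≈P OL.pow PL.X (r ℕ.^ n) →
      ∀ j → j ≤ n → S j ≈ Q n j
    stirling-unique-eL n S eq = stirling-unique n S (λ x → ev-expansion x n S eq)

-- From raw fractions to the field of fractions and back.

module Stirling {c ℓ} (F : CommutativeRing c ℓ) (s : ℕ) (f : Fin (suc (suc s)) → CommutativeRing.Carrier F)
  (isFF : IsFiniteField F (suc (suc s)) f) where
  open CarlitzRing F s f isFF
  open Carlitz F r f
  open CarlitzAlgebra F s f isFF fractionField embed embed-isHomomorphism
  private
    module PL = PolyOps rawFractions
    module OL = RawOps PL.polyRawRing
  open PolynomialMap rawFractions K proj₁ (λ _ _ → ≡.refl) (λ _ _ → ≡.refl) (λ _ → ≡.refl) ≡.refl ≡.refl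

  mapP-eL : ∀ k → mapP (eL k) ≡ e k
  mapP-eL k = ≡.trans (mapP-prod (List.map factor (𝔸< k)))
    (≡.cong (RawOps.prod Kz) (≡.sym (ListP.map-∘ (𝔸< k))))

  Q : ℕ → ℕ → Fraction
  Q n k = quotientD n k , quotientD-nonzero n k

  module _ (n : ℕ) (S : ℕ → FK.Frac) (S-nonzero : ∀ k → k ≤ n → ¬ (FK.den (S k) PA.≈P [])) where

    -- K itself is not a ring: ≈F fails to be transitive at zero denominators.  Hence the defining
    -- identity is lifted along proj₁ to polynomials over the genuine field of fractions.
    S̃ : ℕ → Fraction
    S̃ k with k ℕ.≤? n
    ... | yes k≤n = S k , S-nonzero k k≤n
    -- The identity and the conclusion concern indices up to `n` only, so any genuine fraction can
    -- stand beyond; zero is taken.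
    ... | no  _   = embed []

    proj₁-S̃ : ∀ k → k ≤ n → proj₁ (S̃ k) ≡ S k
    proj₁-S̃ k k≤n with k ℕ.≤? n
    ... | yes _   = ≡.refl
    ... | no  k≰n = contradiction k≤n k≰n

    lhs : PL.Poly
    lhs = OL.sumTo n (λ k → eL k PL.*P PL.const (S̃ k))

    mapP-lhs : mapP lhs ≡ RawOps.sumTo Kz n (λ k → e k PK.*P PK.const (S k))
    mapP-lhs = mapP-sumTo n _ _ (λ k k≤n → ≡.trans (mapP-* (eL k) (PL.const (S̃ k)))
      (≡.cong₂ PK._*P_ (mapP-eL k) (≡.cong PK.const (proj₁-S̃ k k≤n))))

    rhs : PL.Poly
    rhs = OL.pow PL.X (r ℕ.^ n)

    mapP-rhs : mapP rhs ≡ RawOps.pow Kz z (r ℕ.^ n)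
    mapP-rhs = mapP-pow PL.X (r ℕ.^ n)

    stirling : RawOps.sumTo Kz n (λ k → e k PK.*P PK.const (S k)) PK.≈P RawOps.pow Kz z (r ℕ.^ n) →
               ∀ j → j ≤ n → S j FK.≈F quotientD n j
    stirling identity j j≤n = ≡.subst (FK._≈F quotientD n j) (proj₁-S̃ j j≤n)
      (stirling-unique-eL (λ k x y → embed-cancel (D k) x y (D-nonzero k)) Q (λ n k → fraction-*-den (Q n k))
        n S̃ lhs≈rhs j j≤n)
      where
      lhs≈rhs : lhs PL.≈P rhs
      -- Equality of genuine fractions is by definition equality of the underlying pairs, so each
      -- coefficient of the raw identity is already the required equality.
      lhs≈rhs i = ≡.subst₂ FK._≈F_ (coeff-mapP lhs i) (coeff-mapP rhs i)
        (≡.subst₂ PK._≈P_ (≡.sym mapP-lhs) (≡.sym mapP-rhs) identity i)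

theorem2 : ∀ {c ℓ} (F : CommutativeRing c ℓ) (r : ℕ) (f : Fin r → CommutativeRing.Carrier F)
    → PrimePower r → IsFiniteField F r f
    → ∀ (n : ℕ) (S : ℕ → Carlitz.FK.Frac F r f)
    → Carlitz.IsStirling2 F r f n S
    → ∀ (j : ℕ) → j ≤ n
    → Carlitz.FK._≈F_ F r f (S j) (Carlitz.quotientD F r f n j)
-- A field has an element, and 1 differs from 0; this excludes r = 0 and r = 1, and leaves r of the
-- form s + 2.
theorem2 F zero f _ isFF = contradiction (proj₁ (IsFiniteField.f-surj isFF (CommutativeRing.0# F))) (λ ())
theorem2 F (suc zero) f _ isFF = contradiction (1≈0) (IsFiniteField.1≉0 isFF)
  where
  open CommutativeRing F using (_≈_; 0#; 1#; sym; trans)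
  allEqual : ∀ x → x ≈ f zero
  allEqual x with IsFiniteField.f-surj isFF x
  ... | zero , fz≈x = sym fz≈x
  1≈0 : 1# ≈ 0#
  1≈0 = trans (allEqual 1#) (sym (allEqual 0#))
theorem2 F (suc (suc s)) f _ isFF n S (S-nonzero , identity) = Stirling.stirling F s f isFF n S S-nonzero identity
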